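{- Let $t$ be a positive integer. There exists an integer $N$ (depending on $t$) such that for all integers $n,m\ge N$ with $n \ge 8(t+1)^2 m$, there exist $t$-IMOLS$(n;m)$, i.e. a set of $t$ mutually orthogonal incomplete latin squares of order $n$ having a common hole of order $m$.
   Context: An incomplete latin square of order $n$ with a hole of order $m$ is an $n\times n$ array $L=(L_{ij}:i,j\in[n])$ on the symbol set $[n]=\{1,\dots,n\}$, together with a set $M\subseteq[n]$ with $|M|=m$, such that: $L_{ij}$ is empty if $\{i,j\}\subseteq M$; $L_{ij}$ contains exactly one symbol if $\{i,j\}\not\subseteq M$; every row and every column contains each symbol at most once; and symbols in $M$ do not appear in rows or columns indexed by $M$. Two incomplete latin squares $L,L'$ of order $n$ with the same hole $M$ are orthogonal if $\{(L_{ij},L'_{ij}):\{i,j\}\not\subseteq M\}=[n]^2\setminus M^2$. A $t$-IMOLS$(n;m)$ is a set of $t$ such incomplete latin squares of order $n$ with a common hole of order $m$ that are pairwise orthogonal. -}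

module Defs where

open import Data.Nat using (ℕ)
open import Data.Fin using (Fin)
open import Data.Fin.Subset using (Subset; _∈_; _∉_; ∣_∣)
open import Data.Maybe using (Maybe; just; nothing)
open import Data.Product using (_×_; ∃; ∃-syntax; _,_)
open import Relation.Binary.PropositionalEquality using (_≡_)
open import Relation.Nullary using (¬_)

Array : ℕ → Set
Array n = Fin n → Fin n → Maybe (Fin n)

InHole : ∀ {n} → Subset n → Fin n → Fin n → Set
InHole M i j = (i ∈ M) × (j ∈ M)

record IsIncompleteLatinSquare {n : ℕ} (M : Subset n) (L : Array n) : Set where
  field
    hole-empty   : ∀ i j → InHole M i j → L i j ≡ nothing
    filled       : ∀ i j → ¬ InHole M i j → ∃[ s ] L i j ≡ just s
    row-distinct : ∀ i j j' s → L i j ≡ just s → L i j' ≡ just s → j ≡ j'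
    col-distinct : ∀ i i' j s → L i j ≡ just s → L i' j ≡ just s → i ≡ i'
    hole-row     : ∀ i j s → i ∈ M → L i j ≡ just s → s ∉ M
    hole-col     : ∀ i j s → j ∈ M → L i j ≡ just s → s ∉ M

-- Orthogonality: the set {(L_ij, L'_ij) : {i,j} ⊄ M} equals [n]² \ M².
record Orthogonal {n : ℕ} (M : Subset n) (L L' : Array n) : Set where
  field
    pairs-outside : ∀ i j a b → ¬ InHole M i j →
                    L i j ≡ just a → L' i j ≡ just b → ¬ InHole M a b
    pairs-covered : ∀ a b → ¬ InHole M a b →
                    ∃[ i ] ∃[ j ] (¬ InHole M i j × L i j ≡ just a × L' i j ≡ just b)

record IMOLS (t n m : ℕ) : Set where
  field
    hole       : Subset n
    hole-size  : ∣ hole ∣ ≡ m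
    square     : Fin t → Array n
    latin      : ∀ k → IsIncompleteLatinSquare hole (square k)
    orthogonal : ∀ k l → ¬ k ≡ l → Orthogonal hole (square k) (square l)

module Submission where

-- t incomplete mutually orthogonal latin squares are a transversal design with k = t + 2 groups
-- lacking the pairs inside the hole. Everything rests on Wilson's construction: a design with
-- k + 2 groups of size s, together with weights w on k groups and weights h c, γ d on the two
-- others, yields order s w + Σ h + Σ γ with two holes of sizes Σ h and Σ γ, provided there are
-- designs of order w + h c + γ d with holes of sizes h c and γ d. When h c, γ d ≤ 1 these come from
-- latin squares without holes.
--
-- With w = Q - 1 for a product Q of orders of large finite fields divisible by all small numbers,
-- this gives any number of mutually orthogonal latin squares of every large order. For the theorem
-- take a power q of 2 with t + 5 ≤ q ≤ (t + 4)², so that q < 8 (t + 1)². Fix a large z and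
-- put w = (q - 1) z. Removing one block from the linear design over the field of order q before
-- applying Wilson's construction gives order w + z + γ with holes of sizes z and γ ≤ 1. Hence the
-- weights h may be 0, 1 or z. They can be chosen with Σ h = m once s ≥ m / z + z, and since
-- n = s w + m + Σ γ this amounts to n ≥ q m up to a constant.

open import Defs
open import Algebra.Bundles using (AbelianGroup; CommutativeRing)
import Algebra.Construct.DirectProduct as DirectProduct
import Algebra.Properties.Group as GroupProperties
import Algebra.Solver.Ring.NaturalCoefficients.Default as SemiringSolver
open import Data.Empty using (⊥; ⊥-elim)
open import Data.Fin
  using (Fin; zero; suc; toℕ; fromℕ<; combine; remQuot; punchOut; inject≤; splitAt)
import Data.Fin.Properties as Fin
open import Data.Fin.Properties using (suc-injective; _≟_; +↔⊎; *↔×; ∀-cons)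
open import Data.Fin.Subset using (Subset; _∈_; _∉_; ∣_∣; inside; outside)
import Data.Fin.Subset as Subset
open import Data.Fin.Subset.Properties using (_∈?_)
open import Data.Integer using (ℤ; +_; 0ℤ)
import Data.Integer as ℤ
open import Data.Integer.Divisibility.Signed as ℤ∣ using (divides) renaming (_∣_ to _∣ℤ_)
import Data.Integer.DivMod as ℤ
import Data.Integer.Properties as ℤ
import Data.Integer.Tactic.RingSolver as ℤ
open import Data.List using ([]; _∷_)
open import Data.List.Relation.Unary.All using (All; []; _∷_)
open import Data.Maybe using (just; nothing)
open import Data.Maybe.Properties using (just-injective)
open import Data.Nat
  using (ℕ; zero; suc; _+_; _*_; _^_; _∸_; _≤_; _<_; _/_; _%_; z≤n; s≤s; _!; _⊔_;
         NonZero; >-nonZero; >-nonZero⁻¹)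
import Data.Nat as ℕ
open import Data.Nat.Coprimality using (coprime-Bézout; prime⇒coprime)
open import Data.Nat.Divisibility as ℕ using (_∣_; divides)
import Data.Nat.DivMod as ℕDM
open import Data.Nat.GCD using (module Bézout)
open import Data.Nat.ListAction using (product)
open import Data.Nat.Primality using (Prime; prime[2]; prime⇒nonZero; prime⇒nonTrivial)
open import Data.Nat.Primality.Factorisation using (factorise)
import Data.Nat.Properties as ℕ
import Data.Nat.Tactic.RingSolver as ℕ
open import Data.Product using (_×_; ∃; ∃-syntax; ∃₂; _,_; proj₁; proj₂; map)
open import Data.Product.Properties using (,-injective)
open import Data.Sum using (_⊎_; inj₁; inj₂)
open import Data.Sum.Function.Propositional using (_⊎-↔_)
open import Data.Sum.Properties using (inj₁-injective; inj₂-injective; ≡-dec)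
open import Data.Unit using (⊤; tt)
open import Data.Vec using (_++_)
open import Data.Vec.Properties using (lookup-splitAt; lookup⇒[]=; []=⇒lookup; lookup-replicate)
open import Function using (_∘_; _on_)
open import Function.Bundles using (_↔_; Inverse; mk↔ₛ′)
open import Function.Definitions using (Injective)
open import Function.Properties.Inverse using (↔-refl; ↔-sym; ↔-trans)
open import Level using (0ℓ)
open import Relation.Binary using (DecidableEquality; tri<; tri≈; tri>)
open import Relation.Binary.PropositionalEquality as ≡
  using (_≡_; _≢_; cong; cong₂; subst; subst₂; module ≡-Reasoning)
open import Relation.Nullary using (¬_; Dec; yes; no; ¬?)
open import Relation.Nullary.Decidable using (map′; decidable-stable; _×-dec_)

-- Finite rings and fields

-- Equality is a setoid so that ℤ under congruence can serve as carrier; `code` and `decode`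
-- identify the classes with `Fin order`.
record FiniteRing : Set₁ where
  field
    commutativeRing : CommutativeRing 0ℓ 0ℓ
    order           : ℕ
  open CommutativeRing commutativeRing public
    renaming (_+_ to _⊕_; _*_ to _⊗_; -_ to ⊖_)
    hiding (_-_)
  field
    code            : Carrier → Fin order
    decode          : Fin order → Carrier
    code-cong       : ∀ {x y} → x ≈ y → code x ≡ code y
    code-injective  : ∀ {x y} → code x ≡ code y → x ≈ y
    code-decode     : ∀ i → code (decode i) ≡ i

  Unit : Carrier → Set
  Unit x = ∃ λ u → x ⊗ u ≈ 1#

  _≈?_ : ∀ x y → Dec (x ≈ y)
  x ≈? y = map′ code-injective code-cong (code x Fin.≟ code y)

  open GroupProperties +-group public using (∙-cancelˡ; ∙-cancelʳ)
  open SemiringSolver commutativeSemiring public using (solve; _:+_; _:*_; _:=_; con)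
  open import Relation.Binary.Reasoning.Setoid setoid public

  unit-cancelʳ : ∀ {x y z} → Unit z → x ⊗ z ≈ y ⊗ z → x ≈ y
  unit-cancelʳ {x} {y} {z} (u , zu) p = begin
    x            ≈⟨ expand x ⟩
    x ⊗ z ⊗ u    ≈⟨ *-congʳ p ⟩
    y ⊗ z ⊗ u    ≈⟨ expand y ⟨
    y            ∎
    where
    expand : ∀ w → w ≈ w ⊗ z ⊗ u
    expand w = sym (trans (*-assoc w z u) (trans (*-congˡ zu) (*-identityʳ w)))

module _ (F : FiniteRing) where

  open FiniteRing F

  -- The lines y = a e + c, for slopes a and intercepts c, evaluated at k values of e.
  module Lines {k : ℕ} (e : Fin k → Carrier)
               (unit : ∀ {i j} → i ≢ j → Unit (e i ⊕ ⊖ e j)) where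

    line : Carrier × Carrier → Fin k → Carrier
    line (a , c) i = a ⊗ e i ⊕ c

    -- Two values of a line differ by its slope times a difference of evaluation points, a unit for
    -- i ≢ j. Both `through` and `same` rest on this.
    slope : ∀ i j a c → a ⊗ (e i ⊕ ⊖ e j) ⊕ line (a , c) j ≈ line (a , c) i
    slope i j a c = begin
      a ⊗ (e i ⊕ ⊖ e j) ⊕ (a ⊗ e j ⊕ c)
        ≈⟨ solve 5 (λ a c ei ej n → a :* (ei :+ n) :+ (a :* ej :+ c) :=
                                    a :* ei :+ c :+ a :* (ej :+ n)) refl a c (e i) (e j) (⊖ e j) ⟩
      a ⊗ e i ⊕ c ⊕ a ⊗ (e j ⊕ ⊖ e j)  ≈⟨ +-congˡ (*-congˡ (-‿inverseʳ (e j))) ⟩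
      a ⊗ e i ⊕ c ⊕ a ⊗ 0#             ≈⟨ +-congˡ (zeroʳ a) ⟩
      a ⊗ e i ⊕ c ⊕ 0#                 ≈⟨ +-identityʳ _ ⟩
      a ⊗ e i ⊕ c                      ∎

    through : ∀ {i j} → i ≢ j → ∀ x y → ∃ λ b → line b i ≈ x × line b j ≈ y
    through {i} {j} i≢j x y with unit i≢j
    ... | u , du = (a , c) , atI , atJ
      where
      d = e i ⊕ ⊖ e j
      -- The difference quotient, `u` being the inverse of `d`; then `c` gives the line the value y
      -- at e j.
      a = (x ⊕ ⊖ y) ⊗ u
      c = y ⊕ a ⊗ ⊖ e j
      atJ : a ⊗ e j ⊕ c ≈ y
      atJ = begin
        a ⊗ e j ⊕ (y ⊕ a ⊗ ⊖ e j)  ≈⟨ solve 4 (λ a y ej n → a :* ej :+ (y :+ a :* n) :=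
                                        y :+ a :* (ej :+ n)) refl a y (e j) (⊖ e j) ⟩
        y ⊕ a ⊗ (e j ⊕ ⊖ e j)      ≈⟨ +-congˡ (*-congˡ (-‿inverseʳ (e j))) ⟩
        y ⊕ a ⊗ 0#                 ≈⟨ +-congˡ (zeroʳ a) ⟩
        y ⊕ 0#                     ≈⟨ +-identityʳ y ⟩
        y                          ∎
      atI : a ⊗ e i ⊕ c ≈ x
      atI = begin
        a ⊗ e i ⊕ c                ≈⟨ slope i j a c ⟨
        a ⊗ d ⊕ line (a , c) j     ≈⟨ +-congˡ atJ ⟩
        (x ⊕ ⊖ y) ⊗ u ⊗ d ⊕ y      ≈⟨ solve 5 (λ x n u d y → (x :+ n) :* u :* d :+ y :=
                                        (x :+ n) :* (d :* u) :+ y) refl x (⊖ y) u d y ⟩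
        (x ⊕ ⊖ y) ⊗ (d ⊗ u) ⊕ y    ≈⟨ +-congʳ (*-congˡ du) ⟩
        (x ⊕ ⊖ y) ⊗ 1# ⊕ y         ≈⟨ +-congʳ (*-identityʳ _) ⟩
        (x ⊕ ⊖ y) ⊕ y              ≈⟨ +-assoc x (⊖ y) y ⟩
        x ⊕ (⊖ y ⊕ y)              ≈⟨ +-congˡ (-‿inverseˡ y) ⟩
        x ⊕ 0#                     ≈⟨ +-identityʳ x ⟩
        x                          ∎

    same : ∀ {i j} → i ≢ j → ∀ b b′ → line b i ≈ line b′ i → line b j ≈ line b′ j →
           proj₁ b ≈ proj₁ b′ × proj₂ b ≈ proj₂ b′
    same {i} {j} i≢j (a , c) (a′ , c′) p q = a≈ , c≈
      where
      d = e i ⊕ ⊖ e j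
      a≈ : a ≈ a′
      a≈ = unit-cancelʳ (unit i≢j) (∙-cancelʳ (line (a , c) j) (a ⊗ d) (a′ ⊗ d) (begin
        a ⊗ d ⊕ line (a , c) j     ≈⟨ slope i j a c ⟩
        line (a , c) i             ≈⟨ p ⟩
        line (a′ , c′) i           ≈⟨ slope i j a′ c′ ⟨
        a′ ⊗ d ⊕ line (a′ , c′) j  ≈⟨ +-congˡ q ⟨
        a′ ⊗ d ⊕ line (a , c) j    ∎))
      c≈ : c ≈ c′
      c≈ = ∙-cancelˡ (a ⊗ e j) c c′ (trans q (+-congʳ (*-congʳ (sym a≈))))

record FiniteField : Set₁ where
  field finiteRing : FiniteRing
  open FiniteRing finiteRing public
  field
    1≉0     : ¬ 1# ≈ 0#
    inverse : ∀ x → ¬ x ≈ 0# → Unit x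

  x+-y≈0⇒x≈y : ∀ x y → x ⊕ ⊖ y ≈ 0# → x ≈ y
  x+-y≈0⇒x≈y x y p = ∙-cancelʳ (⊖ y) x y (trans p (sym (-‿inverseʳ y)))

-- If `f` were onto, it would have a section `g`, which is injective. The composite g ∘ f fixes the
-- image of `g` but agrees on i and j, so `g` misses one of these, against the pigeonhole principle.
not-surjective : ∀ {n} (f : Fin n → Fin n) {i j} → i ≢ j → f i ≡ f j →
                 ∃ λ y → ∀ x → f x ≢ y
not-surjective {suc n} f {i} {j} i≢j fi≡fj
  with Fin.any? (λ y → ¬? (Fin.any? (λ x → f x Fin.≟ y)))
... | yes (y , missed) = y , λ x p → missed (x , p)
... | no ¬missed = ⊥-elim (conclude (g (f i) Fin.≟ i))
  where
  section : ∀ y → ∃ λ x → f x ≡ y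
  section y = decidable-stable (Fin.any? (λ x → f x Fin.≟ y)) λ ¬s → ¬missed (y , ¬s)
  g = proj₁ ∘ section
  fg : ∀ y → f (g y) ≡ y
  fg y = proj₂ (section y)
  avoids : ∀ x → (∀ y → x ≢ g y) → ⊥
  avoids x x≢g = ℕ.1+n≰n (Fin.injective⇒≤ {f = λ y → punchOut (x≢g y)} λ {y} {y′} p →
    ≡.trans (≡.sym (fg y)) (≡.trans (cong f (Fin.punchOut-injective (x≢g y) (x≢g y′) p)) (fg y′)))
  fixes : ∀ {x} y → x ≡ g y → g (f x) ≡ x
  fixes y ≡.refl = cong g (fg y)
  conclude : Dec (g (f i) ≡ i) → ⊥
  conclude (yes gi) = avoids j λ y p →
    i≢j (≡.trans (≡.sym gi) (≡.trans (cong g fi≡fj) (fixes y p)))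
  conclude (no ¬gi) = avoids i λ y p → ¬gi (fixes y p)

-- The field F[ξ]/(ξ² - ξ - c), where c is a value omitted by x ↦ x(x + 1), so that ξ² - ξ - c has
-- no root - x: such a value exists because this map vanishes at both 0 and - 1.
module Quadratic (F : FiniteField) where
  open FiniteField F

  private
    value : Carrier → Carrier
    value x = x ⊗ (x ⊕ 1#)

    value-cong : ∀ {x y} → x ≈ y → value x ≈ value y
    value-cong p = *-cong p (+-congʳ p)

    0≢-1 : code 0# ≢ code (⊖ 1#)
    0≢-1 p = 1≉0 (begin
      1#           ≈⟨ +-identityʳ 1# ⟨
      1# ⊕ 0#      ≈⟨ +-congˡ (code-injective p) ⟩
      1# ⊕ ⊖ 1#    ≈⟨ -‿inverseʳ 1# ⟩
      0#           ∎)

    omitted : ∃ λ y → ∀ i → code (value (decode i)) ≢ y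
    omitted = not-surjective (λ i → code (value (decode i))) 0≢-1 (code-cong (begin
      value (decode (code 0#))      ≈⟨ value-cong (code-injective (code-decode _)) ⟩
      0# ⊗ (0# ⊕ 1#)                ≈⟨ zeroˡ _ ⟩
      0#                            ≈⟨ zeroʳ _ ⟨
      ⊖ 1# ⊗ 0#                     ≈⟨ *-congˡ (-‿inverseˡ 1#) ⟨
      ⊖ 1# ⊗ (⊖ 1# ⊕ 1#)            ≈⟨ value-cong (code-injective (code-decode _)) ⟨
      value (decode (code (⊖ 1#)))  ∎))

    c : Carrier
    c = decode (proj₁ omitted)

    c-omitted : ∀ x → ¬ value x ≈ c
    c-omitted x p = proj₂ omitted (code x) (≡.trans
      (code-cong (trans (value-cong (code-injective (code-decode _))) p)) (code-decode _))

    K : Set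
    K = Carrier × Carrier

    infixl 7 _⊗²_
    -- The pair (x , y) stands for x + y ξ, multiplied by the rule ξ² = ξ + c.
    _⊗²_ : K → K → K
    (x , y) ⊗² (x′ , y′) = x ⊗ x′ ⊕ c ⊗ (y ⊗ y′) , x ⊗ y′ ⊕ y ⊗ x′ ⊕ y ⊗ y′

    +-group² = DirectProduct.abelianGroup +-abelianGroup +-abelianGroup
    open AbelianGroup +-group² using () renaming (_≈_ to _≈²_)

    ring² : CommutativeRing 0ℓ 0ℓ
    ring² = record
      { _*_ = _⊗²_
      ; 1# = 1# , 0#
      ; isCommutativeRing = record
        { isRing = record
          { +-isAbelianGroup = AbelianGroup.isAbelianGroup +-group²
          ; *-cong = λ (p , q) (p′ , q′) →
              +-cong (*-cong p p′) (*-congˡ (*-cong q q′)) ,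
              +-cong (+-cong (*-cong p q′) (*-cong q p′)) (*-cong q q′)
          ; *-assoc = λ (x , x′) (y , y′) (z , z′) →
              solve 7 (λ c x x′ y y′ z z′ →
                (x :* y :+ c :* (x′ :* y′)) :* z :+ c :* ((x :* y′ :+ x′ :* y :+ x′ :* y′) :* z′) :=
                x :* (y :* z :+ c :* (y′ :* z′)) :+ c :* (x′ :* (y :* z′ :+ y′ :* z :+ y′ :* z′)))
                refl c x x′ y y′ z z′ ,
              solve 7 (λ c x x′ y y′ z z′ →
                (x :* y :+ c :* (x′ :* y′)) :* z′ :+ (x :* y′ :+ x′ :* y :+ x′ :* y′) :* z
                  :+ (x :* y′ :+ x′ :* y :+ x′ :* y′) :* z′ :=
                x :* (y :* z′ :+ y′ :* z :+ y′ :* z′) :+ x′ :* (y :* z :+ c :* (y′ :* z′))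
                  :+ x′ :* (y :* z′ :+ y′ :* z :+ y′ :* z′))
                refl c x x′ y y′ z z′
          ; *-identity =
              (λ (x , x′) →
                solve 3 (λ c x x′ → con 1 :* x :+ c :* (con 0 :* x′) := x) refl c x x′ ,
                solve 2 (λ x x′ → con 1 :* x′ :+ con 0 :* x :+ con 0 :* x′ := x′) refl x x′) ,
              (λ (x , x′) →
                solve 3 (λ c x x′ → x :* con 1 :+ c :* (x′ :* con 0) := x) refl c x x′ ,
                solve 2 (λ x x′ → x :* con 0 :+ x′ :* con 1 :+ x′ :* con 0 := x′) refl x x′)
          ; distrib =
              (λ (x , x′) (y , y′) (z , z′) →
                solve 7 (λ c x x′ y y′ z z′ →
                  x :* (y :+ z) :+ c :* (x′ :* (y′ :+ z′)) :=
                  x :* y :+ c :* (x′ :* y′) :+ (x :* z :+ c :* (x′ :* z′)))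
                  refl c x x′ y y′ z z′ ,
                solve 6 (λ x x′ y y′ z z′ →
                  x :* (y′ :+ z′) :+ x′ :* (y :+ z) :+ x′ :* (y′ :+ z′) :=
                  x :* y′ :+ x′ :* y :+ x′ :* y′ :+ (x :* z′ :+ x′ :* z :+ x′ :* z′))
                  refl x x′ y y′ z z′) ,
              (λ (x , x′) (y , y′) (z , z′) →
                solve 7 (λ c x x′ y y′ z z′ →
                  (y :+ z) :* x :+ c :* ((y′ :+ z′) :* x′) :=
                  y :* x :+ c :* (y′ :* x′) :+ (z :* x :+ c :* (z′ :* x′)))
                  refl c x x′ y y′ z z′ ,
                solve 6 (λ x x′ y y′ z z′ →
                  (y :+ z) :* x′ :+ (y′ :+ z′) :* x :+ (y′ :+ z′) :* x′ :=
                  y :* x′ :+ y′ :* x :+ y′ :* x′ :+ (z :* x′ :+ z′ :* x :+ z′ :* x′))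
                  refl x x′ y y′ z z′)
          }
        ; *-comm = λ (x , x′) (y , y′) →
            solve 5 (λ c x x′ y y′ → x :* y :+ c :* (x′ :* y′) := y :* x :+ c :* (y′ :* x′))
              refl c x x′ y y′ ,
            solve 4 (λ x x′ y y′ → x :* y′ :+ x′ :* y :+ x′ :* y′ :=
                                   y :* x′ :+ y′ :* x :+ y′ :* x′) refl x x′ y y′
        }
      }

    finiteRing² : FiniteRing
    finiteRing² = record
      { commutativeRing = ring²
      ; order = order ℕ.* order
      ; code = λ (x , y) → combine (code x) (code y)
      ; decode = λ i → map decode decode (remQuot order i)
      ; code-cong = λ (p , q) → cong₂ combine (code-cong p) (code-cong q)
      ; code-injective = λ {(x , x′)} {(y , y′)} p →
          let q , q′ = Fin.combine-injective (code x) (code x′) (code y) (code y′) p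
          in code-injective q , code-injective q′
      ; code-decode = λ i → ≡.trans
          (cong₂ combine (code-decode (proj₁ (remQuot order i)))
                         (code-decode (proj₂ (remQuot {order} order i))))
          (Fin.combine-remQuot {order} order i)
      }

    -- This is x² + x y - c y², arranged to be literally the first coordinate of the product with
    -- the conjugate.
    norm : K → Carrier
    norm (x , y) = x ⊗ (x ⊕ y) ⊕ c ⊗ (y ⊗ ⊖ y)

    -- The automorphism ξ ↦ 1 - ξ, which exchanges the roots of ξ² - ξ - c.
    conjugate : K → K
    conjugate (x , y) = x ⊕ y , ⊖ y

    ⊗-conjugate : ∀ z → z ⊗² conjugate z ≈² (norm z , 0#)
    ⊗-conjugate (x , y) = refl , (begin
      x ⊗ ⊖ y ⊕ y ⊗ (x ⊕ y) ⊕ y ⊗ ⊖ y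
        ≈⟨ solve 3 (λ x y n → x :* n :+ y :* (x :+ y) :+ y :* n := (x :+ y) :* (y :+ n))
             refl x y (⊖ y) ⟩
      (x ⊕ y) ⊗ (y ⊕ ⊖ y)  ≈⟨ *-congˡ (-‿inverseʳ y) ⟩
      (x ⊕ y) ⊗ 0#         ≈⟨ zeroʳ _ ⟩
      0#                   ∎)

    norm≈0⇒ : ∀ x y → norm (x , y) ≈ 0# → x ⊗ (x ⊕ y) ≈ c ⊗ (y ⊗ y)
    norm≈0⇒ x y N≈0 = begin
      x ⊗ (x ⊕ y)                              ≈⟨ +-identityʳ _ ⟨
      x ⊗ (x ⊕ y) ⊕ 0#                         ≈⟨ +-congˡ (zeroʳ (c ⊗ y)) ⟨
      x ⊗ (x ⊕ y) ⊕ c ⊗ y ⊗ 0#                 ≈⟨ +-congˡ (*-congˡ (-‿inverseˡ y)) ⟨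
      x ⊗ (x ⊕ y) ⊕ c ⊗ y ⊗ (⊖ y ⊕ y)
        ≈⟨ solve 4 (λ w c y n → w :+ c :* y :* (n :+ y) := w :+ c :* (y :* n) :+ c :* (y :* y))
             refl (x ⊗ (x ⊕ y)) c y (⊖ y) ⟩
      norm (x , y) ⊕ c ⊗ (y ⊗ y)               ≈⟨ +-congʳ N≈0 ⟩
      0# ⊕ c ⊗ (y ⊗ y)                         ≈⟨ +-identityˡ _ ⟩
      c ⊗ (y ⊗ y)                              ∎

    -- If the norm of (x , y) vanishes and y ≠ 0, then value (x / y) = c.
    norm≉0 : ∀ z → ¬ z ≈² (0# , 0#) → ¬ norm z ≈ 0#
    norm≉0 (x , y) z≉0 N≈0 with y ≈? 0#
    ... | yes y≈0 = x≉0 (unit-cancelʳ (inverse x x≉0) x²≈0)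
      where
      x≉0 : ¬ x ≈ 0#
      x≉0 x≈0 = z≉0 (x≈0 , y≈0)
      x²≈0 : x ⊗ x ≈ 0# ⊗ x
      x²≈0 = begin
        x ⊗ x           ≈⟨ *-congˡ (+-identityʳ x) ⟨
        x ⊗ (x ⊕ 0#)    ≈⟨ *-congˡ (+-congˡ y≈0) ⟨
        x ⊗ (x ⊕ y)     ≈⟨ norm≈0⇒ x y N≈0 ⟩
        c ⊗ (y ⊗ y)     ≈⟨ *-congˡ (*-congʳ y≈0) ⟩
        c ⊗ (0# ⊗ y)    ≈⟨ solve 3 (λ c x y → c :* (con 0 :* y) := con 0 :* x) refl c x y ⟩
        0# ⊗ x          ∎
    ... | no y≉0 with inverse y y≉0
    ... | v , yv = c-omitted (x ⊗ v) (begin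
      x ⊗ v ⊗ (x ⊗ v ⊕ 1#)             ≈⟨ *-congˡ (+-congˡ yv) ⟨
      x ⊗ v ⊗ (x ⊗ v ⊕ y ⊗ v)          ≈⟨ solve 3 (λ x y v → x :* v :* (x :* v :+ y :* v) :=
                                            x :* (x :+ y) :* (v :* v)) refl x y v ⟩
      x ⊗ (x ⊕ y) ⊗ (v ⊗ v)            ≈⟨ *-congʳ (norm≈0⇒ x y N≈0) ⟩
      c ⊗ (y ⊗ y) ⊗ (v ⊗ v)            ≈⟨ solve 3 (λ c y v → c :* (y :* y) :* (v :* v) :=
                                            c :* (y :* v) :* (y :* v)) refl c y v ⟩
      c ⊗ (y ⊗ v) ⊗ (y ⊗ v)            ≈⟨ *-cong (*-congˡ yv) yv ⟩
      c ⊗ 1# ⊗ 1#                      ≈⟨ trans (*-identityʳ _) (*-identityʳ c) ⟩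
      c                                ∎)

    scalar-inverse : ∀ {N u} → N ⊗ u ≈ 1# → (N , 0#) ⊗² (u , 0#) ≈² (1# , 0#)
    scalar-inverse {N} {u} p =
      trans (solve 3 (λ N u c → N :* u :+ c :* (con 0 :* con 0) := N :* u) refl N u c) p ,
      solve 2 (λ N u → N :* con 0 :+ con 0 :* u :+ con 0 :* con 0 := con 0) refl N u

  extension : FiniteField
  extension = record
    { finiteRing = finiteRing²
    ; 1≉0 = 1≉0 ∘ proj₁
    -- The inverse of z is its conjugate divided by its norm.
    ; inverse = λ z z≉0 →
        let u , Nu = inverse (norm z) (norm≉0 z z≉0) in
        conjugate z ⊗² (u , 0#) ,
        K.trans (K.sym (K.*-assoc z (conjugate z) (u , 0#)))
          (K.trans (K.*-congʳ (⊗-conjugate z)) (scalar-inverse Nu))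
    }
    where module K = CommutativeRing ring²

-- Integers modulo n and prime fields

private
  close⇒≡ : ∀ {n r r′} → r < n → r′ < n → + n ∣ℤ + r ℤ.- + r′ → r ≡ r′
  close⇒≡ {n} {r} {r′} r<n r′<n n∣ =
    ℤ.+-injective (ℤ.i-j≡0⇒i≡j _ _ (ℤ.∣i∣≡0⇒i≡0 (small (ℤ∣.∣⇒∣ᵤ n∣) bound)))
    where
    small : ∀ {d} → n ∣ d → d < n → d ≡ 0
    small {zero}  _ _   = ≡.refl
    small {suc d} p d<n = ⊥-elim (ℕ.>⇒∤ d<n p)
    bound : ℤ.∣ + r ℤ.- + r′ ∣ < n
    bound rewrite ℤ.m-n≡m⊖n r r′ with ℕ.≤-total r r′
    ... | inj₁ r≤r′ rewrite ℤ.∣⊖∣-≤ r≤r′ = ℕ.≤-<-trans (ℕ.m∸n≤m r′ r) r′<n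
    ... | inj₂ r′≤r rewrite ℤ.∣m⊖n∣≡∣n⊖m∣ r r′ | ℤ.∣⊖∣-≤ r′≤r = ℕ.≤-<-trans (ℕ.m∸n≤m r r′) r<n

-- A record, so that the type displays x and y themselves and not only their difference.
record _≡_[mod_] (x y : ℤ) (n : ℕ) : Set where
  constructor congruent
  field difference : + n ∣ℤ x ℤ.- y

open _≡_[mod_]

integers-mod : (n : ℕ) .{{_ : NonZero n}} → FiniteRing
integers-mod n = record
  { commutativeRing = record
    { _≈_ = _≈_ ; _+_ = ℤ._+_ ; _*_ = ℤ._*_ ; -_ = ℤ.-_ ; 0# = 0ℤ ; 1# = ℤ.1ℤ
    ; isCommutativeRing = record
      { isRing = record
        { +-isAbelianGroup = record
          { isGroup = record
            { isMonoid = record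
              { isSemigroup = record
                { isMagma = record
                  { isEquivalence = record { refl = ≡⇒≈ ≡.refl ; sym = ≈-sym ; trans = ≈-trans }
                  ; ∙-cong = λ {x} {y} {u} {v} p q →
                      congruent (subst (+ n ∣ℤ_) (+-lemma x y u v)
                        (ℤ∣.∣m∣n⇒∣m+n (difference p) (difference q))) }
                ; assoc = λ x y z → ≡⇒≈ (ℤ.+-assoc x y z) }
              ; identity = ≡⇒≈ ∘ ℤ.+-identityˡ , ≡⇒≈ ∘ ℤ.+-identityʳ }
            ; inverse = ≡⇒≈ ∘ ℤ.+-inverseˡ , ≡⇒≈ ∘ ℤ.+-inverseʳ
            ; ⁻¹-cong = λ {x} {y} p →
                congruent (subst (+ n ∣ℤ_) (neg-lemma x y) (ℤ∣.∣m⇒∣-m (difference p))) }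
          ; comm = λ x y → ≡⇒≈ (ℤ.+-comm x y) }
        ; *-cong = λ {x} {y} {u} {v} p q → congruent (subst (+ n ∣ℤ_) (*-lemma x y u v)
            (ℤ∣.∣m∣n⇒∣m+n (ℤ∣.∣n⇒∣m*n u (difference p)) (ℤ∣.∣n⇒∣m*n y (difference q))))
        ; *-assoc = λ x y z → ≡⇒≈ (ℤ.*-assoc x y z)
        ; *-identity = ≡⇒≈ ∘ ℤ.*-identityˡ , ≡⇒≈ ∘ ℤ.*-identityʳ
        ; distrib = (λ x y z → ≡⇒≈ (ℤ.*-distribˡ-+ x y z)) ,
                    (λ x y z → ≡⇒≈ (ℤ.*-distribʳ-+ x y z)) }
      ; *-comm = λ x y → ≡⇒≈ (ℤ.*-comm x y) } }
  ; order = n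
  ; code = residue
  ; decode = λ i → + toℕ i
  ; code-cong = λ {x} {y} p → Fin.fromℕ<-cong _ _
      (close⇒≡ (ℤ.n%ℕd<d x n) (ℤ.n%ℕd<d y n)
        (difference (≈-trans (≈-sym (reduce x)) (≈-trans p (reduce y)))))
      (ℤ.n%ℕd<d x n) (ℤ.n%ℕd<d y n)
  ; code-injective = λ {x} {y} p → ≈-trans (reduce x)
      (≈-trans (≡⇒≈ (cong +_ (Fin.fromℕ<-injective _ _ (ℤ.n%ℕd<d x n) (ℤ.n%ℕd<d y n) p)))
               (≈-sym (reduce y)))
  ; code-decode = λ i → Fin.toℕ-injective
      (≡.trans (Fin.toℕ-fromℕ< _) (ℕDM.m<n⇒m%n≡m (Fin.toℕ<n i)))
  }
  where
  _≈_ : ℤ → ℤ → Set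
  x ≈ y = x ≡ y [mod n ]
  residue : ℤ → Fin n
  residue x = fromℕ< (ℤ.n%ℕd<d x n)
  ≡⇒≈ : ∀ {x y} → x ≡ y → x ≈ y
  ≡⇒≈ {x} ≡.refl = congruent (subst (+ n ∣ℤ_) (≡.sym (ℤ.+-inverseʳ x)) (divides 0ℤ ≡.refl))
  ≈-sym : ∀ {x y} → x ≈ y → y ≈ x
  ≈-sym {x} {y} p = congruent (subst (+ n ∣ℤ_) (lemma x y) (ℤ∣.∣m⇒∣-m (difference p)))
    where
    lemma : ∀ x y → ℤ.- (x ℤ.- y) ≡ y ℤ.- x
    lemma = ℤ.solve-∀
  ≈-trans : ∀ {x y z} → x ≈ y → y ≈ z → x ≈ z
  ≈-trans {x} {y} {z} p q = congruent (subst (+ n ∣ℤ_) (lemma x y z)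
      (ℤ∣.∣m∣n⇒∣m+n (difference p) (difference q)))
    where
    lemma : ∀ x y z → x ℤ.- y ℤ.+ (y ℤ.- z) ≡ x ℤ.- z
    lemma = ℤ.solve-∀
  reduce : ∀ x → x ≈ (+ (x ℤ.%ℕ n))
  reduce x = congruent (divides (x ℤ./ℕ n) (≡.trans
      (cong (ℤ._- + (x ℤ.%ℕ n)) (ℤ.a≡a%ℕn+[a/ℕn]*n x n))
      (lemma (+ (x ℤ.%ℕ n)) (x ℤ./ℕ n ℤ.* + n))))
    where
    lemma : ∀ r m → r ℤ.+ m ℤ.- r ≡ m
    lemma = ℤ.solve-∀
  +-lemma : ∀ x y u v → x ℤ.- y ℤ.+ (u ℤ.- v) ≡ x ℤ.+ u ℤ.- (y ℤ.+ v)
  +-lemma = ℤ.solve-∀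
  neg-lemma : ∀ x y → ℤ.- (x ℤ.- y) ≡ ℤ.- x ℤ.- ℤ.- y
  neg-lemma = ℤ.solve-∀
  *-lemma : ∀ x y u v → u ℤ.* (x ℤ.- y) ℤ.+ y ℤ.* (u ℤ.- v) ≡ x ℤ.* u ℤ.- y ℤ.* v
  *-lemma = ℤ.solve-∀

module _ {n : ℕ} .{{_ : NonZero n}} (a b r : ℕ) where

  open FiniteRing (integers-mod n) using (Unit)

  -- Bézout identities over ℕ come with two signs. Here b inverts r; in `unit⁻`, where r b ≡ -1, the
  -- inverse is - b.
  unit⁺ : r * b ≡ 1 + a * n → Unit (+ r)
  unit⁺ p = + b , congruent (divides (+ a) (E.begin
      + r ℤ.* + b ℤ.- ℤ.1ℤ            E.≡⟨ cong (ℤ._- ℤ.1ℤ) (ℤ.pos-* r b) ⟨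
      + (r * b) ℤ.- ℤ.1ℤ              E.≡⟨ cong (λ m → + m ℤ.- ℤ.1ℤ) p ⟩
      ℤ.1ℤ ℤ.+ + (a * n) ℤ.- ℤ.1ℤ     E.≡⟨ lemma (+ (a * n)) ⟩
      + (a * n)                       E.≡⟨ ℤ.pos-* a n ⟩
      + a ℤ.* + n                     E.∎))
    where
    module E = ≡-Reasoning
    lemma : ∀ m → ℤ.1ℤ ℤ.+ m ℤ.- ℤ.1ℤ ≡ m
    lemma = ℤ.solve-∀

  unit⁻ : 1 + r * b ≡ a * n → Unit (+ r)
  unit⁻ p = ℤ.- + b , congruent (divides (ℤ.- + a) (E.begin
      + r ℤ.* ℤ.- + b ℤ.- ℤ.1ℤ        E.≡⟨ lemma (+ r) (+ b) ⟩
      ℤ.- (ℤ.1ℤ ℤ.+ + r ℤ.* + b)      E.≡⟨ cong (λ m → ℤ.- (ℤ.1ℤ ℤ.+ m)) (ℤ.pos-* r b) ⟨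
      ℤ.- + (1 + r * b)               E.≡⟨ cong (λ m → ℤ.- + m) p ⟩
      ℤ.- + (a * n)                   E.≡⟨ cong ℤ.-_ (ℤ.pos-* a n) ⟩
      ℤ.- (+ a ℤ.* + n)               E.≡⟨ ℤ.neg-distribˡ-* (+ a) (+ n) ⟩
      ℤ.- + a ℤ.* + n                 E.∎))
    where
    module E = ≡-Reasoning
    lemma : ∀ x y → x ℤ.* ℤ.- y ℤ.- ℤ.1ℤ ≡ ℤ.- (ℤ.1ℤ ℤ.+ x ℤ.* y)
    lemma = ℤ.solve-∀

abstract
  -- Every integer is congruent to its remainder; a nonzero remainder below p is coprime to p, so
  -- Bézout yields an inverse.
  prime-field : ∀ {p} → Prime p → ∃ λ (F : FiniteField) → FiniteField.order F ≡ p
  prime-field {p} p-prime = record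
    { finiteRing = integers-mod p ; 1≉0 = 1≉0 ; inverse = inverse } , ≡.refl
    where
    instance
      p≢0 : NonZero p
      p≢0 = prime⇒nonZero p-prime
    open FiniteRing (integers-mod p)
    1≉0 : ¬ ℤ.1ℤ ≈ 0ℤ
    1≉0 q = ℕ.>⇒∤ (ℕ.nonTrivial⇒n>1 p {{prime⇒nonTrivial p-prime}}) (ℤ∣.∣⇒∣ᵤ (difference q))
    unit : ∀ r → r < p → ¬ + r ≈ 0ℤ → Unit (+ r)
    unit zero      r<p r≉0 = ⊥-elim (r≉0 refl)
    unit r@(suc _) r<p r≉0 with coprime-Bézout (prime⇒coprime p-prime r<p)
    ... | Bézout.+- a b eq = unit⁻ a b r (≡.trans (cong suc (ℕ.*-comm r b)) eq)
    ... | Bézout.-+ a b eq = unit⁺ a b r (≡.trans (ℕ.*-comm r b) (≡.sym eq))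
    reduced : ∀ x → x ≈ decode (code x)
    reduced x = code-injective (≡.sym (code-decode (code x)))
    inverse : ∀ x → ¬ x ≈ 0ℤ → Unit x
    inverse x x≉0 with unit (toℕ (code x)) (Fin.toℕ<n (code x)) (λ q → x≉0 (trans (reduced x) q))
    ... | u , q = u , trans (*-congʳ {u} {x} {decode (code x)} (reduced x)) q

1<order : (F : FiniteField) → 1 < FiniteField.order F
1<order F with FiniteField.order F | FiniteField.code F
             | FiniteField.code-injective F | FiniteField.1≉0 F
... | 0             | code | _   | _   with () ← code (FiniteField.0# F)
... | suc (suc _)   | _    | _   | _   = s≤s (s≤s z≤n)
... | 1             | code | inj | 1≉0 = ⊥-elim (1≉0 (inj (all-equal _ _)))
  where
  all-equal : (x y : Fin 1) → x ≡ y
  all-equal zero zero = ≡.refl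

-- Transversal designs

open ≡ using (refl; sym; trans)

-- A transversal design with k groups, each a copy of X: its blocks are k-tuples, and a pair of
-- points x, y in two distinct groups lies on a block exactly when R x y. Blocks need not have
-- decidable or even extensional equality, so uniqueness only speaks of their points.
record TD (k : ℕ) (X : Set) (R : X → X → Set) : Set₁ where
  field
    Block  : Set
    pt     : Block → Fin k → X
    meets  : ∀ {i j} → i ≢ j → ∀ b → R (pt b i) (pt b j)
    block  : ∀ {i j} → i ≢ j → ∀ {x y} → R x y → ∃ λ b → pt b i ≡ x × pt b j ≡ y
    unique : ∀ {i j} → i ≢ j → ∀ b b′ → pt b i ≡ pt b′ i → pt b j ≡ pt b′ j →
             ∀ l → pt b l ≡ pt b′ l

Full : {X : Set} → X → X → Set
Full _ _ = ⊤

Image : {X Y : Set} → (X → Y) → (X → X → Set) → Y → Y → Set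
Image e R y y′ = ∃₂ λ x x′ → e x ≡ y × e x′ ≡ y′ × R x x′

module _ {k : ℕ} {X : Set} {R : X → X → Set} where

  restrict : TD (suc k) X R → TD k X R
  restrict T = record
    { Block  = Block
    ; pt     = λ b i → pt b (suc i)
    ; meets  = λ i≢j → meets (i≢j ∘ suc-injective)
    ; block  = λ i≢j → block (i≢j ∘ suc-injective)
    ; unique = λ i≢j b b′ p q l → unique (i≢j ∘ suc-injective) b b′ p q (suc l)
    } where open TD T

  -- Points outside the image of `e` lie in no allowed pair, so this also places a small design
  -- inside a larger set of points.
  embed : {Y : Set} {R′ : Y → Y → Set} (e : X → Y) → Injective _≡_ _≡_ e →
          (∀ {x x′} → R x x′ → R′ (e x) (e x′)) →
          (∀ {y y′} → R′ y y′ → Image e R y y′) →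
          TD k X R → TD k Y R′
  embed e e-inj to from T = record
    { Block  = Block
    ; pt     = λ b i → e (pt b i)
    ; meets  = λ i≢j b → to (meets i≢j b)
    ; block  = block′
    ; unique = λ i≢j b b′ p q l → cong e (unique i≢j b b′ (e-inj p) (e-inj q) l)
    }
    where
    open TD T
    block′ : ∀ {i j} → i ≢ j → ∀ {x y} → _ → ∃ λ b → e (pt b i) ≡ x × e (pt b j) ≡ y
    block′ i≢j r with from r
    ... | _ , _ , p , q , s with block i≢j s
    ... | b , p′ , q′ = b , trans (cong e p′) p , trans (cong e q′) q

  transport : {Y : Set} {R′ : Y → Y → Set} (φ : X ↔ Y) → let open Inverse φ in
              (∀ x x′ → R x x′ → R′ (to x) (to x′)) →
              (∀ y y′ → R′ y y′ → R (from y) (from y′)) →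
              TD k X R → TD k Y R′
  transport φ f g = embed to inj (f _ _) λ {y} {y′} r →
      from y , from y′ , strictlyInverseˡ y , strictlyInverseˡ y′ , g _ _ r
    where
    open Inverse φ
    inj : Injective _≡_ _≡_ to
    inj {x} {y} p = trans (sym (strictlyInverseʳ x)) (trans (cong from p) (strictlyInverseʳ y))

  weaken : {R′ : X → X → Set} → (∀ x y → R x y → R′ x y) → (∀ x y → R′ x y → R x y) →
           TD k X R → TD k X R′
  weaken f g = embed (λ x → x) (λ p → p) (f _ _) λ r → _ , _ , refl , refl , g _ _ r

  -- Blocks of different origin cannot agree in two groups: the common pair would satisfy both
  -- relations.
  union : {R′ : X → X → Set} → (∀ {x y} → R x y → R′ x y → ⊥) →
          TD k X R → TD k X R′ → TD k X (λ x y → R x y ⊎ R′ x y)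
  union {R′} disjoint T T′ = record
    { Block = T.Block ⊎ T′.Block ; pt = pt ; meets = meets ; block = block ; unique = unique }
    where
    module T = TD T
    module T′ = TD T′
    pt : T.Block ⊎ T′.Block → Fin k → X
    pt (inj₁ b) = T.pt b
    pt (inj₂ b) = T′.pt b
    meets : ∀ {i j} → i ≢ j → ∀ b → R (pt b i) (pt b j) ⊎ R′ (pt b i) (pt b j)
    meets i≢j (inj₁ b) = inj₁ (T.meets i≢j b)
    meets i≢j (inj₂ b) = inj₂ (T′.meets i≢j b)
    block : ∀ {i j} → i ≢ j → ∀ {x y} → R x y ⊎ R′ x y → ∃ λ b → pt b i ≡ x × pt b j ≡ y
    block i≢j (inj₁ r) = let b , p = T.block i≢j r in inj₁ b , p
    block i≢j (inj₂ r) = let b , p = T′.block i≢j r in inj₂ b , p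
    clash : ∀ {i j} → i ≢ j → ∀ b b′ → T.pt b i ≡ T′.pt b′ i → T.pt b j ≡ T′.pt b′ j → ⊥
    clash i≢j b b′ p q = disjoint (subst₂ R p q (T.meets i≢j b)) (T′.meets i≢j b′)
    unique : ∀ {i j} → i ≢ j → ∀ b b′ → pt b i ≡ pt b′ i → pt b j ≡ pt b′ j →
             ∀ l → pt b l ≡ pt b′ l
    unique i≢j (inj₁ b) (inj₁ b′) p q = T.unique i≢j b b′ p q
    unique i≢j (inj₂ b) (inj₂ b′) p q = T′.unique i≢j b b′ p q
    unique i≢j (inj₁ b) (inj₂ b′) p q = ⊥-elim (clash i≢j b b′ p q)
    unique i≢j (inj₂ b) (inj₁ b′) p q = ⊥-elim (clash i≢j b′ b (sym p) (sym q))

-- Constant blocks; they restore, at points satisfying `P`, the diagonal pairs that `idempotent`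
-- deletes.
diagonal : ∀ {k X} (P : X → Set) → TD k X (λ x y → x ≡ y × P x)
diagonal P = record
  { Block  = ∃ P
  ; pt     = λ (x , _) _ → x
  ; meets  = λ _ (x , p) → refl , p
  ; block  = λ { _ (refl , p) → (_ , p) , refl , refl }
  ; unique = λ _ _ _ p _ _ → p
  }

-- MacNeish's product of sets of orthogonal latin squares.
direct-product : ∀ {k X Y} → TD k X Full → TD k Y Full → TD k (X × Y) Full
direct-product T T′ = record
  { Block  = T.Block × T′.Block
  ; pt     = λ (b , b′) i → T.pt b i , T′.pt b′ i
  ; meets  = λ _ _ → tt
  ; block  = λ i≢j _ →
      let b , p , q = T.block i≢j tt ; b′ , p′ , q′ = T′.block i≢j tt
      in (b , b′) , cong₂ _,_ p p′ , cong₂ _,_ q q′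
  ; unique = λ i≢j (b , b′) (c , c′) p q l →
      let p₁ , p₂ = ,-injective p ; q₁ , q₂ = ,-injective q
      in cong₂ _,_ (T.unique i≢j b c p₁ q₁ l) (T′.unique i≢j b′ c′ p₂ q₂ l)
  }
  where
  module T = TD T
  module T′ = TD T′

-- The blocks through a point a₀ of the first group form a parallel class; relabelling each
-- remaining group along it turns these blocks into the diagonal, which is then deleted.
idempotent : ∀ {k X} → X → TD (2 + k) X Full → TD (1 + k) X _≢_
idempotent {k} {X} a₀ T = record
  { Block  = ∃ λ b → pt b zero ≢ a₀
  ; pt     = λ (b , _) i → ν i (pt b (suc i))
  ; meets  = λ i≢j (b , b≢) → meets′ i≢j b b≢
  ; block  = block′
  ; unique = λ i≢j (b , _) (b′ , _) p q l →
      cong (ν l) (unique (i≢j ∘ suc-injective) b b′ (ν-injective _ p) (ν-injective _ q) (suc l))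
  }
  where
  open TD T
  0≢s : ∀ {n} {i : Fin n} → zero ≢ suc i
  0≢s ()
  class : (i : Fin (suc k)) (y : X) → ∃ λ b → pt b zero ≡ a₀ × pt b (suc i) ≡ y
  class i y = block 0≢s tt
  -- The new label of y is the point of group `suc zero` on the class block through y.
  ν : Fin (suc k) → X → X
  ν i y = pt (proj₁ (class i y)) (suc zero)
  ν-≡ : ∀ i b → pt b zero ≡ a₀ → ν i (pt b (suc i)) ≡ pt b (suc zero)
  ν-≡ i b p with class i (pt b (suc i))
  ... | c , q , r = unique 0≢s c b (trans q (sym p)) r (suc zero)
  ν-same : ∀ i j {x y} → ν i x ≡ ν j y →
           ∀ l → pt (proj₁ (class i x)) l ≡ pt (proj₁ (class j y)) l
  ν-same i j {x} {y} p =
    unique 0≢s _ _ (trans (proj₁ (proj₂ (class i x))) (sym (proj₁ (proj₂ (class j y))))) p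
  ν-injective : ∀ i {x y} → ν i x ≡ ν i y → x ≡ y
  ν-injective i {x} {y} p = trans (sym (proj₂ (proj₂ (class i x))))
    (trans (ν-same i i p (suc i)) (proj₂ (proj₂ (class i y))))
  -- If two labels on b agreed, one class block would share two points with b, forcing b through
  -- `a₀`.
  meets′ : ∀ {i j} → i ≢ j → ∀ b → pt b zero ≢ a₀ →
           ν i (pt b (suc i)) ≢ ν j (pt b (suc j))
  meets′ {i} {j} i≢j b b≢ p = b≢ (trans (sym (unique (i≢j ∘ suc-injective) c b
      (proj₂ (proj₂ ci)) (trans (ν-same i j p (suc j)) (proj₂ (proj₂ (class j _)))) zero))
      (proj₁ (proj₂ ci)))
    where
    ci = class i (pt b (suc i))
    c = proj₁ ci
  block′ : ∀ {i j} → i ≢ j → ∀ {x y} → x ≢ y →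
           ∃ λ (c : ∃ λ b → pt b zero ≢ a₀) →
             ν i (pt (proj₁ c) (suc i)) ≡ x × ν j (pt (proj₁ c) (suc j)) ≡ y
  block′ {i} {j} i≢j {x} {y} x≢y
    -- The class blocks labelled x and y tell which two old points to join. Were the joining block b
    -- in the class, it would coincide with both, giving x ≡ y.
    with block {suc zero} {zero} (λ ()) {x} {a₀} tt | block {suc zero} {zero} (λ ()) {y} {a₀} tt
  ... | c , refl , cz | d , refl , dz
    with block (i≢j ∘ suc-injective) {pt c (suc i)} {pt d (suc j)} tt
  ... | b , p , q = (b , λ b₀ → x≢y (trans
          (sym (unique 0≢s b c (trans b₀ (sym cz)) p (suc zero)))
          (unique 0≢s b d (trans b₀ (sym dz)) q (suc zero))))
      , trans (cong (ν i) p) (ν-≡ i c cz) , trans (cong (ν j) q) (ν-≡ j d dz)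

-- All pairs allowed by R on W, and all remaining pairs except those inside A or inside G.
Holes : {W A G : Set} → (W → W → Set) → W ⊎ (A ⊎ G) → W ⊎ (A ⊎ G) → Set
Holes R (inj₁ w)        (inj₁ w′)       = R w w′
Holes R (inj₁ _)        (inj₂ (inj₁ _)) = ⊤
Holes R (inj₁ _)        (inj₂ (inj₂ _)) = ⊤
Holes R (inj₂ (inj₁ _)) (inj₁ _)        = ⊤
Holes R (inj₂ (inj₁ _)) (inj₂ (inj₁ _)) = ⊥
Holes R (inj₂ (inj₁ _)) (inj₂ (inj₂ _)) = ⊤
Holes R (inj₂ (inj₂ _)) (inj₁ _)        = ⊤
Holes R (inj₂ (inj₂ _)) (inj₂ (inj₁ _)) = ⊤
Holes R (inj₂ (inj₂ _)) (inj₂ (inj₂ _)) = ⊥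

-- Wilson's construction: every point of the last k groups of the master design gets weight W,
-- the points of the first two groups get weights A and G.
module Wilson {k : ℕ} {S : Set} {R : S → S → Set} (master : TD (2 + k) S R)
              {W : Set} {A G : S → Set}
              -- A point of positive weight has to be joined to every point, since only pairs inside
              -- one hole may lack a block through its copies.
              (okA : ∀ {c} → A c → ∀ p → R p c × R c p)
              (okG : ∀ {c} → G c → ∀ p → R p c × R c p)
              (ingredient : ∀ c d → TD k (W ⊎ (A c ⊎ G d)) (Holes Full)) where

  open TD master
  private module I c d = TD (ingredient c d)

  Point : Set
  Point = (S × W) ⊎ (∃ A ⊎ ∃ G)

  Allowed : Point → Point → Set
  Allowed = Holes (R on proj₁)

  private
    place : S → ∀ c d → W ⊎ (A c ⊎ G d) → Point
    place p c d (inj₁ w)        = inj₁ (p , w)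
    place p c d (inj₂ (inj₁ a)) = inj₂ (inj₁ (c , a))
    place p c d (inj₂ (inj₂ g)) = inj₂ (inj₂ (d , g))

    place-injective : ∀ p c d {v v′} → place p c d v ≡ place p c d v′ → v ≡ v′
    place-injective p c d {inj₁ _}        {inj₁ _}        refl = refl
    place-injective p c d {inj₂ (inj₁ _)} {inj₂ (inj₁ _)} refl = refl
    place-injective p c d {inj₂ (inj₂ _)} {inj₂ (inj₂ _)} refl = refl
    place-injective p c d {inj₁ _}        {inj₂ (inj₁ _)} ()
    place-injective p c d {inj₁ _}        {inj₂ (inj₂ _)} ()
    place-injective p c d {inj₂ (inj₁ _)} {inj₁ _}        ()
    place-injective p c d {inj₂ (inj₁ _)} {inj₂ (inj₂ _)} ()
    place-injective p c d {inj₂ (inj₂ _)} {inj₁ _}        ()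
    place-injective p c d {inj₂ (inj₂ _)} {inj₂ (inj₁ _)} ()

    -- The master group from which a point of the new group i stems. All new groups share the first
    -- two master groups, which supply the holes.
    group : ∀ {A G : Set} → Fin k → W ⊎ (A ⊎ G) → Fin (2 + k)
    group i (inj₁ _)        = suc (suc i)
    group i (inj₂ (inj₁ _)) = zero
    group i (inj₂ (inj₂ _)) = suc zero

    -- Two points of one hole would stem from the same master group, hence the holes; every other
    -- pair determines a master block.
    group-distinct : ∀ {A G : Set} {i j} → i ≢ j → ∀ (v v′ : W ⊎ (A ⊎ G)) →
                     Holes Full v v′ → group i v ≢ group j v′
    group-distinct i≢j (inj₁ _)        (inj₁ _)        _ = i≢j ∘ suc-injective ∘ suc-injective
    group-distinct i≢j (inj₁ _)        (inj₂ (inj₁ _)) _ = λ ()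
    group-distinct i≢j (inj₁ _)        (inj₂ (inj₂ _)) _ = λ ()
    group-distinct i≢j (inj₂ (inj₁ _)) (inj₁ _)        _ = λ ()
    group-distinct i≢j (inj₂ (inj₁ _)) (inj₂ (inj₂ _)) _ = λ ()
    group-distinct i≢j (inj₂ (inj₂ _)) (inj₁ _)        _ = λ ()
    group-distinct i≢j (inj₂ (inj₂ _)) (inj₂ (inj₁ _)) _ = λ ()

    putAt : ∀ b → Fin k → W ⊎ (A (pt b zero) ⊎ G (pt b (suc zero))) → Point
    putAt b i = place (pt b (suc (suc i))) (pt b zero) (pt b (suc zero))

    put-group : ∀ b b′ i v v′ → putAt b i v ≡ putAt b′ i v′ →
                group i v ≡ group i v′ × pt b (group i v) ≡ pt b′ (group i v)
    put-group b b′ i (inj₁ _)        (inj₁ _)        p = refl , cong proj₁ (inj₁-injective p)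
    put-group b b′ i (inj₂ (inj₁ _)) (inj₂ (inj₁ _)) p =
      refl , cong proj₁ (inj₁-injective (inj₂-injective p))
    put-group b b′ i (inj₂ (inj₂ _)) (inj₂ (inj₂ _)) p =
      refl , cong proj₁ (inj₂-injective (inj₂-injective p))
    put-group b b′ i (inj₁ _)        (inj₂ (inj₁ _)) ()
    put-group b b′ i (inj₁ _)        (inj₂ (inj₂ _)) ()
    put-group b b′ i (inj₂ (inj₁ _)) (inj₁ _)        ()
    put-group b b′ i (inj₂ (inj₁ _)) (inj₂ (inj₂ _)) ()
    put-group b b′ i (inj₂ (inj₂ _)) (inj₁ _)        ()
    put-group b b′ i (inj₂ (inj₂ _)) (inj₂ (inj₁ _)) ()

    put-allowed : ∀ {i j} → i ≢ j → ∀ b v v′ → Holes Full v v′ →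
                  Allowed (putAt b i v) (putAt b j v′)
    put-allowed i≢j b (inj₁ _)        (inj₁ _)        _ =
      meets (i≢j ∘ suc-injective ∘ suc-injective) b
    put-allowed i≢j b (inj₁ _)        (inj₂ (inj₁ _)) _ = tt
    put-allowed i≢j b (inj₁ _)        (inj₂ (inj₂ _)) _ = tt
    put-allowed i≢j b (inj₂ (inj₁ _)) (inj₁ _)        _ = tt
    put-allowed i≢j b (inj₂ (inj₁ _)) (inj₂ (inj₂ _)) _ = tt
    put-allowed i≢j b (inj₂ (inj₂ _)) (inj₁ _)        _ = tt
    put-allowed i≢j b (inj₂ (inj₂ _)) (inj₂ (inj₁ _)) _ = tt

    base : Point → S
    base (inj₁ (p , _))        = p
    base (inj₂ (inj₁ (c , _))) = c
    base (inj₂ (inj₂ (d , _))) = d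

    base-allowed : ∀ x y → Allowed x y → R (base x) (base y)
    base-allowed (inj₁ _)              (inj₁ _)              r = r
    base-allowed (inj₁ (p , _))        (inj₂ (inj₁ (_ , a))) _ = proj₁ (okA a p)
    base-allowed (inj₁ (p , _))        (inj₂ (inj₂ (_ , g))) _ = proj₁ (okG g p)
    base-allowed (inj₂ (inj₁ (_ , a))) (inj₁ (p , _))        _ = proj₂ (okA a p)
    base-allowed (inj₂ (inj₁ (_ , a))) (inj₂ (inj₂ (d , _))) _ = proj₂ (okA a d)
    base-allowed (inj₂ (inj₂ (_ , g))) (inj₁ (p , _))        _ = proj₂ (okG g p)
    base-allowed (inj₂ (inj₂ (_ , g))) (inj₂ (inj₁ (c , _))) _ = proj₂ (okG g c)

    forget : Point → W ⊎ (∃ A ⊎ ∃ G)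
    forget (inj₁ (_ , w)) = inj₁ w
    forget (inj₂ z)       = inj₂ z

    forget-allowed : ∀ x y → Allowed x y → Holes Full (forget x) (forget y)
    forget-allowed (inj₁ _)        (inj₁ _)        _ = tt
    forget-allowed (inj₁ _)        (inj₂ (inj₁ _)) _ = tt
    forget-allowed (inj₁ _)        (inj₂ (inj₂ _)) _ = tt
    forget-allowed (inj₂ (inj₁ _)) (inj₁ _)        _ = tt
    forget-allowed (inj₂ (inj₁ _)) (inj₂ (inj₂ _)) _ = tt
    forget-allowed (inj₂ (inj₂ _)) (inj₁ _)        _ = tt
    forget-allowed (inj₂ (inj₂ _)) (inj₂ (inj₁ _)) _ = tt

    -- Records that a point and its coordinate in an ingredient are of the same kind, so that being
    -- allowed passes from one to the other.
    data Under : ∀ {c d} → Point → W ⊎ (A c ⊎ G d) → Set where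
      under-W : ∀ {c d p w} → Under {c} {d} (inj₁ (p , w)) (inj₁ w)
      under-A : ∀ {c d a}   → Under {c} {d} (inj₂ (inj₁ (c , a))) (inj₂ (inj₁ a))
      under-G : ∀ {c d g}   → Under {c} {d} (inj₂ (inj₂ (d , g))) (inj₂ (inj₂ g))

    pull : ∀ b i x → pt b (group i (forget x)) ≡ base x →
           ∃ λ v → putAt b i v ≡ x × Under x v
    pull b i (inj₁ (_ , w))        refl = inj₁ w , refl , under-W
    pull b i (inj₂ (inj₁ (_ , a))) refl = inj₂ (inj₁ a) , refl , under-A
    pull b i (inj₂ (inj₂ (_ , g))) refl = inj₂ (inj₂ g) , refl , under-G

    under-allowed : ∀ {c d x y} {v v′ : W ⊎ (A c ⊎ G d)} → Under x v → Under y v′ →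
                    Allowed x y → Holes Full v v′
    under-allowed under-W under-W _ = tt
    under-allowed under-W under-A _ = tt
    under-allowed under-W under-G _ = tt
    under-allowed under-A under-W _ = tt
    under-allowed under-A under-G _ = tt
    under-allowed under-G under-W _ = tt
    under-allowed under-G under-A _ = tt

    NewBlock : Set
    NewBlock = ∃ λ b → I.Block (pt b zero) (pt b (suc zero))

    new-pt : NewBlock → Fin k → Point
    new-pt (b , v) i = putAt b i (I.pt _ _ v i)

    new-block : ∀ {i j} → i ≢ j → ∀ {x y} → Allowed x y →
                ∃ λ b → new-pt b i ≡ x × new-pt b j ≡ y
    new-block {i} {j} i≢j {x} {y} r
      with block (group-distinct i≢j (forget x) (forget y) (forget-allowed x y r))
                 (base-allowed x y r)
    ... | b , p , q with pull b i x p | pull b j y q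
    ... | v , v≡ , uv | v′ , v′≡ , uv′ with I.block _ _ i≢j (under-allowed uv uv′ r)
    ... | e , eᵢ , eⱼ = (b , e) , trans (cong (putAt b i) eᵢ) v≡ , trans (cong (putAt b j) eⱼ) v′≡

    -- The ingredient depends on c and d, and two master blocks agree only propositionally there.
    -- Separate variables let these equations be matched before the uniqueness of the ingredient
    -- applies.
    same-block : ∀ {c c′ d d′} → c ≡ c′ → d ≡ d′ →
                 ∀ (P P′ : Fin k → S) → (∀ l → P l ≡ P′ l) →
                 ∀ {i j} → i ≢ j → ∀ v v′ →
                 let at  = λ l → place (P l) c d (I.pt c d v l)
                     at′ = λ l → place (P′ l) c′ d′ (I.pt c′ d′ v′ l)
                 in at i ≡ at′ i → at j ≡ at′ j → ∀ l → at l ≡ at′ l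
    same-block {c} {_} {d} refl refl P P′ P≗P′ {i} {j} i≢j v v′ p q l =
      cong₂ (λ s → place s c d) (P≗P′ l) (I.unique c d i≢j v v′ (strip p) (strip q) l)
      where
      strip : ∀ {m} → place (P m) c d (I.pt c d v m) ≡ place (P′ m) c d (I.pt c d v′ m) →
              I.pt c d v m ≡ I.pt c d v′ m
      strip {m} r rewrite P≗P′ m = place-injective _ c d r

    new-unique : ∀ {i j} → i ≢ j → ∀ b b′ → new-pt b i ≡ new-pt b′ i →
                 new-pt b j ≡ new-pt b′ j → ∀ l → new-pt b l ≡ new-pt b′ l
    new-unique {i} {j} i≢j (b , v) (b′ , v′) p q =
      same-block (b≗b′ zero) (b≗b′ (suc zero)) _ _ (λ l → b≗b′ (suc (suc l))) i≢j v v′ p q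
      where
      b≗b′ : ∀ l → pt b l ≡ pt b′ l
      b≗b′ = unique (group-distinct i≢j _ _ (I.meets _ _ i≢j v)) b b′
               (proj₂ (put-group b b′ i _ _ p)) (proj₂ (put-group b b′ j _ _ q))

  design : TD k Point Allowed
  design = record
    { Block  = NewBlock
    ; pt     = new-pt
    ; meets  = λ i≢j (b , v) → put-allowed i≢j b (I.pt _ _ v _) (I.pt _ _ v _) (I.meets _ _ i≢j v)
    ; block  = new-block
    ; unique = new-unique
    }

-- Equivalent to k - 2 mutually orthogonal latin squares of order n.
Good : ℕ → ℕ → Set₁
Good k n = TD k (Fin n) Full

-- For k at least 2 this amounts to k - 2 orthogonal incomplete squares of order w + a + g with
-- disjoint holes of sizes a and g.
ITD : ℕ → ℕ → ℕ → ℕ → Set₁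
ITD k w a g = TD k (Fin w ⊎ (Fin a ⊎ Fin g)) (Holes Full)

Good-* : ∀ {k m n} → Good k m → Good k n → Good k (m * n)
Good-* T T′ = transport (↔-sym *↔×) (λ _ _ _ → tt) (λ _ _ _ → tt) (direct-product T T′)

InW : {W H : Set} → W ⊎ H → Set
InW (inj₁ _) = ⊤
InW (inj₂ _) = ⊥

InA : {W A G : Set} → W ⊎ (A ⊎ G) → Set
InA (inj₁ _)        = ⊥
InA (inj₂ (inj₁ _)) = ⊤
InA (inj₂ (inj₂ _)) = ⊥

≤1⇒irrelevant : ∀ {a} → a ≤ 1 → (x y : Fin a) → x ≡ y
≤1⇒irrelevant (s≤s z≤n) zero zero = refl

-- A pair inside a hole of at most one point is a diagonal pair. So the diagonal is removed and put
-- back on the part outside the holes.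
small-holes : ∀ {k w a g} → Fin w → a ≤ 1 → g ≤ 1 →
              Good (2 + k) (w + (a + g)) → ITD (1 + k) w a g
small-holes {k} {w} {a} {g} w₀ a≤1 g≤1 T =
  weaken to from (union (λ x≢y → x≢y ∘ proj₁)
    (idempotent (inj₁ w₀) (transport φ (λ _ _ _ → tt) (λ _ _ _ → tt) T)) (diagonal InW))
  where
  X = Fin w ⊎ (Fin a ⊎ Fin g)
  φ : Fin (w + (a + g)) ↔ X
  φ = ↔-trans +↔⊎ (↔-refl ⊎-↔ +↔⊎)
  _≟X_ : DecidableEquality X
  _≟X_ = ≡-dec _≟_ (≡-dec _≟_ _≟_)
  apart : ∀ x y → x ≢ y → Holes Full x y
  apart (inj₁ _)        (inj₁ _)        _ = tt
  apart (inj₁ _)        (inj₂ (inj₁ _)) _ = tt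
  apart (inj₁ _)        (inj₂ (inj₂ _)) _ = tt
  apart (inj₂ (inj₁ _)) (inj₁ _)        _ = tt
  apart (inj₂ (inj₁ x)) (inj₂ (inj₁ y)) p = p (cong (inj₂ ∘ inj₁) (≤1⇒irrelevant a≤1 x y))
  apart (inj₂ (inj₁ _)) (inj₂ (inj₂ _)) _ = tt
  apart (inj₂ (inj₂ _)) (inj₁ _)        _ = tt
  apart (inj₂ (inj₂ _)) (inj₂ (inj₁ _)) _ = tt
  apart (inj₂ (inj₂ x)) (inj₂ (inj₂ y)) p = p (cong (inj₂ ∘ inj₂) (≤1⇒irrelevant g≤1 x y))
  to : ∀ x y → x ≢ y ⊎ (x ≡ y × InW x) → Holes Full x y
  to _ _ (inj₁ p) = apart _ _ p
  to (inj₁ _) _ (inj₂ (refl , _)) = tt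
  self : ∀ (x : X) → Holes Full x x → InW x
  self (inj₁ _) _ = tt
  self (inj₂ (inj₁ _)) ()
  self (inj₂ (inj₂ _)) ()
  from : ∀ x y → Holes Full x y → x ≢ y ⊎ (x ≡ y × InW x)
  from x y r with x ≟X y
  ... | no p     = inj₁ p
  ... | yes refl = inj₂ (refl , self x r)

-- The second hole receives a complete design; only the first remains.
fill : ∀ {k W A G} → TD k (W ⊎ (A ⊎ G)) (Holes Full) → TD k G Full →
       TD k (W ⊎ (A ⊎ G)) (λ x y → ¬ (InA x × InA y))
fill T T′ = weaken to from
    (union disjoint T (embed (inj₂ ∘ inj₂) (inj₂-injective ∘ inj₂-injective)
      (λ r → _ , _ , refl , refl , r) (λ r → r) T′))
  where
  disjoint : ∀ {x y} → Holes Full x y → Image (inj₂ ∘ inj₂) Full x y → ⊥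
  disjoint () (_ , _ , refl , refl , _)
  to : ∀ x y → Holes Full x y ⊎ Image (inj₂ ∘ inj₂) Full x y → ¬ (InA x × InA y)
  to (inj₂ (inj₁ _)) (inj₂ (inj₁ _)) (inj₁ ()) _
  to (inj₂ (inj₁ _)) (inj₂ (inj₁ _)) (inj₂ (_ , _ , () , _)) _
  from : ∀ x y → ¬ (InA x × InA y) → Holes Full x y ⊎ Image (inj₂ ∘ inj₂) Full x y
  from (inj₁ _)        (inj₁ _)        _ = inj₁ tt
  from (inj₁ _)        (inj₂ (inj₁ _)) _ = inj₁ tt
  from (inj₁ _)        (inj₂ (inj₂ _)) _ = inj₁ tt
  from (inj₂ (inj₁ _)) (inj₁ _)        _ = inj₁ tt
  from (inj₂ (inj₁ _)) (inj₂ (inj₁ _)) p = ⊥-elim (p (tt , tt))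
  from (inj₂ (inj₁ _)) (inj₂ (inj₂ _)) _ = inj₁ tt
  from (inj₂ (inj₂ _)) (inj₁ _)        _ = inj₁ tt
  from (inj₂ (inj₂ _)) (inj₂ (inj₁ _)) _ = inj₁ tt
  from (inj₂ (inj₂ _)) (inj₂ (inj₂ _)) _ = inj₂ (_ , _ , refl , refl , tt)

Holes-map : ∀ {W A G W′ A′ G′ : Set} (f : W ↔ W′) (g : A ↔ A′) (h : G ↔ G′) x y →
            Holes Full x y → let to = Inverse.to (f ⊎-↔ (g ⊎-↔ h)) in Holes Full (to x) (to y)
Holes-map f g h (inj₁ _)        (inj₁ _)        _ = tt
Holes-map f g h (inj₁ _)        (inj₂ (inj₁ _)) _ = tt
Holes-map f g h (inj₁ _)        (inj₂ (inj₂ _)) _ = tt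
Holes-map f g h (inj₂ (inj₁ _)) (inj₁ _)        _ = tt
Holes-map f g h (inj₂ (inj₁ _)) (inj₂ (inj₂ _)) _ = tt
Holes-map f g h (inj₂ (inj₂ _)) (inj₁ _)        _ = tt
Holes-map f g h (inj₂ (inj₂ _)) (inj₂ (inj₁ _)) _ = tt

relabel : ∀ {k} {W A G W′ A′ G′ : Set} → W ↔ W′ → A ↔ A′ → G ↔ G′ →
          TD k (W ⊎ (A ⊎ G)) (Holes Full) → TD k (W′ ⊎ (A′ ⊎ G′)) (Holes Full)
relabel f g h = transport (f ⊎-↔ (g ⊎-↔ h)) (Holes-map f g h)
  (Holes-map (↔-sym f) (↔-sym g) (↔-sym h))

-- Wilson's construction with numerical weights

total : ∀ {s} → (Fin s → ℕ) → ℕ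
total {zero}  h = 0
total {suc s} h = h zero + total (h ∘ suc)

Σ-Fin : ∀ {s} (h : Fin s → ℕ) → ∃ (Fin ∘ h) ↔ Fin (total h)
Σ-Fin {zero}  h = mk↔ₛ′ (λ ()) (λ ()) (λ ()) (λ ())
Σ-Fin {suc s} h = ↔-trans split (↔-trans (↔-refl ⊎-↔ Σ-Fin (h ∘ suc)) (↔-sym +↔⊎))
  where
  split : ∃ (Fin ∘ h) ↔ (Fin (h zero) ⊎ ∃ (Fin ∘ h ∘ suc))
  split = mk↔ₛ′ (λ { (zero , x) → inj₁ x ; (suc c , x) → inj₂ (c , x) })
                (λ { (inj₁ x) → zero , x ; (inj₂ (c , x)) → suc c , x })
                (λ { (inj₁ _) → refl ; (inj₂ _) → refl })
                (λ { (zero , _) → refl ; (suc _ , _) → refl })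

wilson : ∀ {k s w} (h γ : Fin s → ℕ) → Good (2 + k) s →
         (∀ c d → ITD k w (h c) (γ d)) → ITD k (s * w) (total h) (total γ)
wilson {w = w} h γ master ingredient =
  relabel (↔-sym *↔×) (Σ-Fin h) (Σ-Fin γ) (weaken to from design)
  where
  open Wilson master {Fin w} {Fin ∘ h} {Fin ∘ γ} (λ _ _ → tt , tt) (λ _ _ → tt , tt) ingredient
  to : ∀ x y → Allowed x y → Holes Full x y
  to (inj₁ _)        (inj₁ _)        _ = tt
  to (inj₁ _)        (inj₂ (inj₁ _)) _ = tt
  to (inj₁ _)        (inj₂ (inj₂ _)) _ = tt
  to (inj₂ (inj₁ _)) (inj₁ _)        _ = tt
  to (inj₂ (inj₁ _)) (inj₂ (inj₂ _)) _ = tt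
  to (inj₂ (inj₂ _)) (inj₁ _)        _ = tt
  to (inj₂ (inj₂ _)) (inj₂ (inj₁ _)) _ = tt
  from : ∀ x y → Holes Full x y → Allowed x y
  from (inj₁ _)        (inj₁ _)        _ = tt
  from (inj₁ _)        (inj₂ (inj₁ _)) _ = tt
  from (inj₁ _)        (inj₂ (inj₂ _)) _ = tt
  from (inj₂ (inj₁ _)) (inj₁ _)        _ = tt
  from (inj₂ (inj₁ _)) (inj₂ (inj₂ _)) _ = tt
  from (inj₂ (inj₂ _)) (inj₁ _)        _ = tt
  from (inj₂ (inj₂ _)) (inj₂ (inj₁ _)) _ = tt

-- Wilson's construction on a master design from which one block has been removed: the
-- weighted points of the removed block form the hole.
wilson-block : ∀ {k q z} (γ : Fin (suc q) → ℕ) → γ zero ≡ 0 → Good (3 + k) (suc q) →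
               (∀ d → ITD k z 0 (γ d)) → ITD k (q * z) z (total γ)
wilson-block {k} {q} {z} γ γ₀ T ingredient =
  relabel (↔-sym *↔×) ↔-refl (Σ-Fin γ) (transport φ to from′ design)
  where
  -- After `idempotent` the block to be removed is the constant one at `zero`; the other constant
  -- blocks return.
  R : Fin (suc q) → Fin (suc q) → Set
  R x y = ¬ (x ≡ zero × y ≡ zero)
  master : TD (2 + k) (Fin (suc q)) R
  master = weaken fwd bwd
      (union (λ x≢y → x≢y ∘ proj₁) (idempotent zero T) (diagonal (_≢ zero)))
    where
    fwd : ∀ x y → x ≢ y ⊎ (x ≡ y × x ≢ zero) → R x y
    fwd _ _ (inj₁ x≢y)         (refl , refl) = x≢y refl
    fwd _ _ (inj₂ (_ , x≢0)) (p , _)         = x≢0 p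
    bwd : ∀ x y → R x y → x ≢ y ⊎ (x ≡ y × x ≢ zero)
    bwd x y r with x ≟ y
    ... | no x≢y   = inj₁ x≢y
    ... | yes refl = inj₂ (refl , λ p → r (p , p))
  -- Only the pair of two `zero`s is missing, so weighted points must differ from `zero`, as `γ₀`
  -- guarantees.
  okG : ∀ {c} → Fin (γ c) → ∀ p → R p c × R c p
  okG {zero} g p rewrite γ₀ with () ← g
  okG {suc c} g p = (λ ()) , (λ ())
  open Wilson master {Fin z} {λ _ → Fin 0} {Fin ∘ γ} (λ ()) okG (λ _ → ingredient)
  -- The first group has weight 0. The hole consists instead of the z copies of `zero`, no two of
  -- which are joined.
  φ : Point ↔ ((Fin q × Fin z) ⊎ (Fin z ⊎ ∃ (Fin ∘ γ)))
  φ = mk↔ₛ′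
    (λ { (inj₁ (zero , w))  → inj₂ (inj₁ w)
       ; (inj₁ (suc p , w)) → inj₁ (p , w)
       ; (inj₂ (inj₂ g))    → inj₂ (inj₂ g) })
    (λ { (inj₁ (p , w))  → inj₁ (suc p , w)
       ; (inj₂ (inj₁ w)) → inj₁ (zero , w)
       ; (inj₂ (inj₂ g)) → inj₂ (inj₂ g) })
    (λ { (inj₁ _) → refl ; (inj₂ (inj₁ _)) → refl ; (inj₂ (inj₂ _)) → refl })
    (λ { (inj₁ (zero , _)) → refl ; (inj₁ (suc _ , _)) → refl ; (inj₂ (inj₂ _)) → refl })
  open Inverse φ using (from) renaming (to to push)
  to : ∀ x y → Allowed x y → Holes Full (push x) (push y)
  to (inj₁ (zero , _))  (inj₁ (zero , _))  r = ⊥-elim (r (refl , refl))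
  to (inj₁ (zero , _))  (inj₁ (suc _ , _)) _ = tt
  to (inj₁ (suc _ , _)) (inj₁ (zero , _))  _ = tt
  to (inj₁ (suc _ , _)) (inj₁ (suc _ , _)) _ = tt
  to (inj₁ (zero , _))  (inj₂ (inj₂ _))    _ = tt
  to (inj₁ (suc _ , _)) (inj₂ (inj₂ _))    _ = tt
  to (inj₂ (inj₂ _))    (inj₁ (zero , _))  _ = tt
  to (inj₂ (inj₂ _))    (inj₁ (suc _ , _)) _ = tt
  to (inj₂ (inj₂ _))    (inj₂ (inj₁ ()))   _
  to (inj₂ (inj₂ _))    (inj₂ (inj₂ _))    ()
  from′ : ∀ x y → Holes Full x y → Allowed (from x) (from y)
  from′ (inj₁ _)        (inj₁ _)        _ = λ ()
  from′ (inj₁ _)        (inj₂ (inj₁ _)) _ = λ ()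
  from′ (inj₁ _)        (inj₂ (inj₂ _)) _ = tt
  from′ (inj₂ (inj₁ _)) (inj₁ _)        _ = λ ()
  from′ (inj₂ (inj₁ _)) (inj₂ (inj₂ _)) _ = tt
  from′ (inj₂ (inj₂ _)) (inj₁ _)        _ = tt
  from′ (inj₂ (inj₂ _)) (inj₂ (inj₁ _)) _ = tt

-- Division of a hole size by z then needs only about one z-th as many points as weights 0 and 1
-- alone would.
weights : ∀ z {s} x y → x + y ≤ s →
          ∃ λ (h : Fin s → ℕ) → total h ≡ x * z + y × ∀ c → h c ≡ 0 ⊎ h c ≡ 1 ⊎ h c ≡ z
weights z {zero}  zero    zero    _       = (λ ()) , refl , λ ()
weights z {suc s} zero    zero    _       with weights z {s} 0 0 z≤n
... | h , p , q = ∀-cons 0 h , p , ∀-cons (inj₁ refl) q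
weights z {suc s} zero    (suc y) (s≤s l) with weights z 0 y l
... | h , p , q = ∀-cons 1 h , cong suc p , ∀-cons (inj₂ (inj₁ refl)) q
weights z {suc s} (suc x) y       (s≤s l) with weights z x y l
... | h , p , q = ∀-cons z h , trans (cong (λ x → z + x) p) (sym (ℕ.+-assoc z (x * z) y))
                , ∀-cons (inj₂ (inj₂ refl)) q

-- From designs to incomplete latin squares

module _ {t n : ℕ} (M : Subset n) (T : TD (2 + t) (Fin n) (λ x y → ¬ InHole M x y)) where

  open TD T

  inHole? : ∀ i j → _
  inHole? i j = (i ∈? M) ×-dec (j ∈? M)

  cell : ∀ {i j} → ¬ InHole M i j → ∃ λ b → pt b zero ≡ i × pt b (suc zero) ≡ j
  cell = block (λ ())

  -- The first two groups index rows and columns; each later group holds the symbols of one square.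
  square : Fin t → Array n
  square k i j with inHole? i j
  ... | yes _ = nothing
  ... | no ¬h = just (pt (proj₁ (cell ¬h)) (suc (suc k)))

  square-just : ∀ {i j k s} → square k i j ≡ just s →
                ∃ λ b → pt b zero ≡ i × pt b (suc zero) ≡ j × pt b (suc (suc k)) ≡ s
  square-just {i} {j} p with inHole? i j
  square-just refl | no ¬h = let b , q , r = cell ¬h in b , q , r , refl

  -- By uniqueness an entry can be read off any block through its row and column, not just the one
  -- chosen by `cell`.
  square-block : ∀ {i j} k b → pt b zero ≡ i → pt b (suc zero) ≡ j →
                 square k i j ≡ just (pt b (suc (suc k)))
  square-block {i} {j} k b refl refl with inHole? i j
  ... | yes h = ⊥-elim (meets (λ ()) b h)
  ... | no ¬h = let c , q , r = cell ¬h in cong just (unique (λ ()) c b q r (suc (suc k)))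

  square-latin : ∀ k → IsIncompleteLatinSquare M (square k)
  square-latin k = record
    { hole-empty = empty ; filled = filled ; row-distinct = row ; col-distinct = col
    ; hole-row = hole-row ; hole-col = hole-col }
    where
    empty : ∀ i j → InHole M i j → square k i j ≡ nothing
    empty i j h with inHole? i j
    ... | yes _ = refl
    ... | no ¬h = ⊥-elim (¬h h)
    filled : ∀ i j → ¬ InHole M i j → ∃ λ s → square k i j ≡ just s
    filled i j ¬h = let b , p , q = cell ¬h in _ , square-block k b p q
    row : ∀ i j j′ s → square k i j ≡ just s → square k i j′ ≡ just s → j ≡ j′
    row i j j′ s p p′ =
      let b , q , r , u = square-just p ; b′ , q′ , r′ , u′ = square-just p′
      in trans (sym r) (trans (unique {zero} {suc (suc k)} (λ ()) b b′
           (trans q (sym q′)) (trans u (sym u′)) (suc zero)) r′)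
    col : ∀ i i′ j s → square k i j ≡ just s → square k i′ j ≡ just s → i ≡ i′
    col i i′ j s p p′ =
      let b , q , r , u = square-just p ; b′ , q′ , r′ , u′ = square-just p′
      in trans (sym q) (trans (unique {suc zero} {suc (suc k)} (λ ()) b b′
           (trans r (sym r′)) (trans u (sym u′)) zero) q′)
    hole-row : ∀ i j s → i ∈ M → square k i j ≡ just s → s ∉ M
    hole-row i j s i∈M p s∈M with square-just p
    ... | b , refl , _ , refl = meets {zero} {suc (suc k)} (λ ()) b (i∈M , s∈M)
    hole-col : ∀ i j s → j ∈ M → square k i j ≡ just s → s ∉ M
    hole-col i j s j∈M p s∈M with square-just p
    ... | b , _ , refl , refl = meets {suc zero} {suc (suc k)} (λ ()) b (j∈M , s∈M)

  square-orthogonal : ∀ k l → ¬ k ≡ l → Orthogonal M (square k) (square l)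
  square-orthogonal k l k≢l = record { pairs-outside = outside′ ; pairs-covered = covered }
    where
    k≢l′ : suc (suc k) ≢ suc (suc l)
    k≢l′ = k≢l ∘ suc-injective ∘ suc-injective
    outside′ : ∀ i j a b → ¬ InHole M i j → square k i j ≡ just a → square l i j ≡ just b →
               ¬ InHole M a b
    outside′ i j a b ¬h p p′ with square-just p
    ... | c , q , r , refl = subst (λ s → ¬ InHole M _ s)
      (just-injective (trans (sym (square-block l c q r)) p′)) (meets k≢l′ c)
    covered : ∀ a b → ¬ InHole M a b →
              ∃ λ i → ∃ λ j → ¬ InHole M i j × square k i j ≡ just a × square l i j ≡ just b
    covered a b ¬h with block k≢l′ ¬h
    ... | c , refl , refl = pt c zero , pt c (suc zero) , meets (λ ()) c
                          , square-block k c refl refl , square-block l c refl refl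

  TD⇒IMOLS : ∀ {m} → ∣ M ∣ ≡ m → IMOLS t n m
  TD⇒IMOLS ∣M∣ = record
    { hole = M ; hole-size = ∣M∣ ; square = square
    ; latin = square-latin ; orthogonal = square-orthogonal }

initial : ∀ m v → Subset (m + v)
initial m v = Subset.⊤ {m} ++ Subset.⊥ {v}

∣initial∣ : ∀ m v → ∣ initial m v ∣ ≡ m
∣initial∣ zero    zero    = refl
∣initial∣ zero    (suc v) = ∣initial∣ zero v
∣initial∣ (suc m) v       = cong suc (∣initial∣ m v)

∈initial⇒ : ∀ m v {i} → i ∈ initial m v → InW (splitAt m i)
∈initial⇒ m v {i} i∈ with splitAt m i | lookup-splitAt m (Subset.⊤ {m}) (Subset.⊥ {v}) i
... | inj₁ _ | _ = tt
... | inj₂ j | p with () ← trans (sym ([]=⇒lookup i∈)) (trans p (lookup-replicate j outside))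

⇒∈initial : ∀ m v {i} → InW (splitAt m i) → i ∈ initial m v
⇒∈initial m v {i} i∈ with splitAt m i | lookup-splitAt m (Subset.⊤ {m}) (Subset.⊥ {v}) i
... | inj₁ j | p = lookup⇒[]= i _ (trans p (lookup-replicate j inside))

-- The hole of size u is filled, and the one of size m is moved to the front, where `initial`
-- expects it.
ITD⇒IMOLS : ∀ {t w m u} → ITD (2 + t) w m u → Good (2 + t) u → IMOLS t (m + (w + u)) m
ITD⇒IMOLS {t} {w} {m} {u} T T′ = TD⇒IMOLS (initial m (w + u)) design (∣initial∣ m (w + u))
  where
  swap : (Fin w ⊎ (Fin m ⊎ Fin u)) ↔ (Fin m ⊎ (Fin w ⊎ Fin u))
  swap = mk↔ₛ′
    (λ { (inj₁ x) → inj₂ (inj₁ x) ; (inj₂ (inj₁ x)) → inj₁ x ; (inj₂ (inj₂ x)) → inj₂ (inj₂ x) })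
    (λ { (inj₁ x) → inj₂ (inj₁ x) ; (inj₂ (inj₁ x)) → inj₁ x ; (inj₂ (inj₂ x)) → inj₂ (inj₂ x) })
    (λ { (inj₁ _) → refl ; (inj₂ (inj₁ _)) → refl ; (inj₂ (inj₂ _)) → refl })
    (λ { (inj₁ _) → refl ; (inj₂ (inj₁ _)) → refl ; (inj₂ (inj₂ _)) → refl })
  φ : (Fin w ⊎ (Fin m ⊎ Fin u)) ↔ Fin (m + (w + u))
  φ = ↔-trans swap (↔-sym (↔-trans +↔⊎ (↔-refl ⊎-↔ +↔⊎)))
  open Inverse φ
  from-hole : ∀ y → y ∈ initial m (w + u) → InA (from y)
  from-hole y y∈ with splitAt m y | ∈initial⇒ m (w + u) y∈
  ... | inj₁ _ | _ = tt
  hole-from : ∀ y → InA (from y) → y ∈ initial m (w + u)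
  hole-from y h = ⇒∈initial m (w + u) (go h)
    where
    go : InA (from y) → InW (splitAt m y)
    go h with splitAt m y
    ... | inj₁ _ = tt
    ... | inj₂ v with splitAt w v
    go () | inj₂ v | inj₁ _
    go () | inj₂ v | inj₂ _
  hole-to : ∀ x → to x ∈ initial m (w + u) → InA x
  hole-to x h = subst InA (strictlyInverseʳ x) (from-hole (to x) h)
  design : TD (2 + t) (Fin (m + (w + u))) (λ x y → ¬ InHole (initial m (w + u)) x y)
  design = transport φ (λ _ _ r (p , q) → r (hole-to _ p , hole-to _ q))
                       (λ _ _ r (p , q) → r (hole-from _ p , hole-from _ q)) (fill T T′)

-- Designs from lines over finite rings

lines : ∀ {k} (F : FiniteRing) → let open FiniteRing F in (e : Fin k → Carrier) →
        (∀ {i j} → i ≢ j → Unit (e i ⊕ ⊖ e j)) → Good k order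
lines F e unit = record
  { Block  = Carrier × Carrier
  ; pt     = λ b i → code (line b i)
  ; meets  = λ _ _ → tt
  ; block  = λ {i} {j} i≢j {x} {y} _ → let b , p , q = through i≢j (decode x) (decode y) in
      b , trans (code-cong p) (code-decode x) , trans (code-cong q) (code-decode y)
  ; unique = λ i≢j b b′ p q l →
      let a≈ , c≈ = same i≢j b b′ (code-injective p) (code-injective q)
      in code-cong (+-cong (*-congʳ a≈) c≈)
  }
  where
  open FiniteRing F using (Carrier; code; decode; code-cong; code-injective; code-decode;
                           +-cong; *-congʳ)
  open Lines F e unit

field-Good : ∀ {k} (F : FiniteField) → k ≤ FiniteField.order F → Good k (FiniteField.order F)
field-Good {k} F k≤q = lines finiteRing e λ {i} {j} i≢j → inverse _ λ p →
    i≢j (Fin.inject≤-injective k≤q k≤q i j (trans (sym (code-decode _))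
      (trans (code-cong (x+-y≈0⇒x≈y (e i) (e j) p)) (code-decode _))))
  where
  open FiniteField F using (finiteRing; Carrier; inverse; decode; code-decode; code-cong;
                            x+-y≈0⇒x≈y)
  e : Fin k → Carrier
  e i = decode (inject≤ i k≤q)

-- The lines evaluated at 0, 1, …, k - 1.
mod-Good : ∀ {k} n .{{_ : NonZero n}} →
           (∀ d → 1 ≤ d → d < k → ∃₂ λ a b → d * b ≡ 1 + a * n ⊎ 1 + d * b ≡ a * n) →
           Good k n
mod-Good {k} n inverses = lines (integers-mod n) (λ i → + toℕ i) unit
  where
  open FiniteRing (integers-mod n) using (Unit)
  minus : ∀ x u → x ℤ.* u ≡ ℤ.- x ℤ.* ℤ.- u
  minus = ℤ.solve-∀
  units : ∀ d → 1 ≤ d → d < k → Unit (+ d)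
  units d 1≤d d<k with inverses d 1≤d d<k
  ... | a , b , inj₁ p = unit⁺ a b d p
  ... | a , b , inj₂ p = unit⁻ a b d p
  unit : ∀ {i j : Fin k} → i ≢ j → Unit (+ toℕ i ℤ.+ ℤ.- + toℕ j)
  unit {i} {j} i≢j rewrite ℤ.m-n≡m⊖n (toℕ i) (toℕ j) with ℕ.<-cmp (toℕ i) (toℕ j)
  ... | tri≈ _ p _ = ⊥-elim (i≢j (Fin.toℕ-injective p))
  ... | tri> _ _ j<i rewrite ℤ.⊖-≥ (ℕ.<⇒≤ j<i) =
    units _ (ℕ.m<n⇒0<n∸m j<i) (ℕ.≤-<-trans (ℕ.m∸n≤m _ (toℕ j)) (Fin.toℕ<n i))
  -- The difference is negative, so its inverse is minus that of its absolute value.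
  ... | tri< i<j _ _ rewrite ℤ.⊖-< i<j
    with units _ (ℕ.m<n⇒0<n∸m i<j) (ℕ.≤-<-trans (ℕ.m∸n≤m _ (toℕ i)) (Fin.toℕ<n j))
  ... | u , p = ℤ.- u , subst (λ z → z ≡ ℤ.1ℤ [mod n ]) (minus (+ (toℕ j ℕ.∸ toℕ i)) u) p

-- Many mutually orthogonal latin squares of every large order

q<q² : (F : FiniteField) → let open FiniteField F in order < order * order
q<q² F = ℕ.m<m*n order order {{>-nonZero (ℕ.<⇒≤ (1<order F))}} (1<order F)
  where open FiniteField F using (order)

-- Each quadratic extension squares the order, which increases it and keeps it a multiple of the old
-- one.
large-extension : ∀ k (F : FiniteField) →
                  ∃ λ F′ → k ≤ FiniteField.order F′ × FiniteField.order F ∣ FiniteField.order F′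
large-extension zero    F = F , z≤n , ℕ.∣-refl
large-extension (suc k) F with large-extension k F
... | F′ , k≤q , q∣q′ = Quadratic.extension F′ , ℕ.≤-<-trans k≤q (q<q² F′) , ℕ.∣m⇒∣m*n _ q∣q′

-- Repeated squaring of the order, starting from 4.
field-near : ∀ j → ∃ λ F → 3 + j ≤ FiniteField.order F × FiniteField.order F ≤ (2 + j) * (2 + j)
field-near zero = squared (prime-field prime[2])
  where
  squared : (∃ λ F → FiniteField.order F ≡ 2) →
            ∃ λ F → 3 ≤ FiniteField.order F × FiniteField.order F ≤ 4
  squared (F , p) = Quadratic.extension F ,
    subst (λ q → 3 ≤ q * q × q * q ≤ 4) (sym p) (ℕ.n≤1+n 3 , ℕ.≤-refl)
field-near (suc j) with field-near j
... | F , lower , upper with ℕ.m≤n⇒m<n∨m≡n lower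
... | inj₁ larger = F , larger , ℕ.≤-trans upper (ℕ.*-mono-≤ (ℕ.n≤1+n (2 + j)) (ℕ.n≤1+n (2 + j)))
-- An order of 3 + j is just too small, and its square meets the new upper bound exactly.
... | inj₂ equal  = Quadratic.extension F , subst (_< order * order) (sym equal) (q<q² F)
                  , ℕ.≤-reflexive (cong₂ _*_ (sym equal) (sym equal))
  where open FiniteField F using (order)

Good-1 : ∀ {k} → Good k 1
Good-1 = weaken (λ _ _ _ → tt) (λ { zero zero _ → refl , zero }) (diagonal (λ _ → Fin 1))

-- Every prime factor of n is replaced by a power of it that is the order of a field with at least k
-- elements.
Good-multiple : ∀ k n .{{_ : NonZero n}} → ∃ λ Q → Good k Q × n ∣ Q × 1 ≤ Q
Good-multiple k n with factorise n
... | record { factors = ps ; isFactorisation = refl ; factorsPrime = primes } = go ps primes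
  where
  go : ∀ ps → All Prime ps → ∃ λ Q → Good k Q × product ps ∣ Q × 1 ≤ Q
  go []       []             = 1 , Good-1 , ℕ.∣-refl , ℕ.≤-refl
  go (p ∷ ps) (p-prime ∷ primes) with go ps primes | prime-field p-prime
  ... | Q , good , ps∣Q , 1≤Q | F , refl with large-extension k F
  ... | F′ , k≤q , p∣q = _ , Good-* (field-Good F′ k≤q) good , ℕ.*-pres-∣ p∣q ps∣Q
                       , ℕ.*-mono-≤ (ℕ.<⇒≤ (1<order F′)) 1≤Q

total-0 : ∀ s → total {s} (λ _ → 0) ≡ 0
total-0 zero    = refl
total-0 (suc s) = total-0 s

bits : ∀ {s} u → u ≤ s → ∃ λ (γ : Fin s → ℕ) → total γ ≡ u × ∀ c → γ c ≡ 0 ⊎ γ c ≡ 1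
bits u u≤s with weights 0 0 u u≤s
... | γ , p , q = γ , p , bit ∘ q
  where
  bit : ∀ {a} → a ≡ 0 ⊎ a ≡ 1 ⊎ a ≡ 0 → a ≡ 0 ⊎ a ≡ 1
  bit (inj₁ p)        = inj₁ p
  bit (inj₂ (inj₁ p)) = inj₂ p
  bit (inj₂ (inj₂ p)) = inj₁ p

fill-all : ∀ {k v u} → ITD k v 0 u → Good k u → Good k (v + u)
fill-all {k} {v} {u} T T′ = transport (↔-sym (↔-trans +↔⊎ (↔-refl ⊎-↔ +↔⊎)))
    (λ _ _ _ → tt) (λ _ _ _ (p , _) → none p) (fill T T′)
  where
  none : {x : Fin v ⊎ (Fin 0 ⊎ Fin u)} → ¬ InA x
  none {inj₂ (inj₁ ())}

-- One weighted group is empty, the other is truncated to u points; these form a single hole, which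
-- is then filled.
wilson-MOLS : ∀ {k s w u} → Good (2 + k) s → ITD k w 0 0 → ITD k w 0 1 → u ≤ s →
              Good k u → Good k (s * w + u)
wilson-MOLS {k} {s} {w} master T₀ T₁ u≤s T′ with bits _ u≤s
... | γ , refl , γ-bit = fill-all
    (subst (λ a → ITD k (s * w) a (total γ)) (total-0 s)
      (wilson (λ _ → 0) γ master λ _ d → ingredient (γ-bit d))) T′
  where
  ingredient : ∀ {g} → g ≡ 0 ⊎ g ≡ 1 → ITD k w 0 g
  ingredient (inj₁ refl) = T₀
  ingredient (inj₂ refl) = T₁

d∣D! : ∀ {d D} → 1 ≤ d → d ≤ D → d ∣ D !
d∣D! {suc d} _ d≤D = ℕ.∣-trans (ℕ.m∣m*n (d !)) (ℕ.m≤n⇒m!∣n! d≤D)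

-- With Q divisible by all small numbers and w = Q - 1, orders s ≡ 1 (mod Q) are good, and
-- n = s w + u ≡ u - 1 (mod Q): starting from n ≡ 1, all residues are reached one after another.
module Residues (k w : ℕ) .{{_ : NonZero w}} (small : ∀ d → 1 ≤ d → d < 3 + k → d ∣ suc w)
                (good-Q : Good (2 + k) (suc w)) where

  Q : ℕ
  Q = suc w

  -- A small d divides Q, and Q l ≡ -1 modulo 1 + Q l, so d is a unit.
  good-1+Ql : ∀ l → Good (3 + k) (1 + Q * l)
  good-1+Ql l = mod-Good (1 + Q * l) λ d 1≤d d< → inverse d (small d 1≤d d<)
    where
    open ≡-Reasoning
    inverse : ∀ d → d ∣ Q →
              ∃₂ λ a b → d * b ≡ 1 + a * (1 + Q * l) ⊎ 1 + d * b ≡ a * (1 + Q * l)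
    inverse d (divides e p) = 1 , e * l , inj₂ (begin
      1 + d * (e * l)    ≡⟨ cong suc (ℕ.*-assoc d e l) ⟨
      1 + d * e * l      ≡⟨ cong (λ x → 1 + x * l) (trans (ℕ.*-comm d e) (sym p)) ⟩
      1 + Q * l          ≡⟨ ℕ.*-identityˡ _ ⟨
      1 * (1 + Q * l)    ∎)

  -- Here Q ≡ 1 modulo w, so the cofactor of d in Q is its inverse.
  good-w : Good (3 + k) w
  good-w = mod-Good w λ d 1≤d d< → inverse d (small d 1≤d d<)
    where
    inverse : ∀ d → d ∣ Q → ∃₂ λ a b → d * b ≡ 1 + a * w ⊎ 1 + d * b ≡ a * w
    inverse d (divides e p) = 1 , e ,
      inj₁ (trans (ℕ.*-comm d e) (trans (sym p) (cong suc (sym (ℕ.*-identityˡ w)))))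

  first : Fin w
  first = fromℕ< (>-nonZero⁻¹ w)

  -- Weights 0 and 1 call for the orders w and w + 1 = Q.
  T₀ : ITD (1 + k) w 0 0
  T₀ = small-holes first z≤n z≤n (subst (Good (2 + k)) (sym (ℕ.+-identityʳ w)) (restrict good-w))

  T₁ : ITD (1 + k) w 0 1
  T₁ = small-holes first z≤n ℕ.≤-refl (subst (Good (2 + k)) (ℕ.+-comm 1 w) good-Q)

  -- All orders n ≡ 1 - r modulo Q from U on are good.
  Reached : ℕ → ℕ → Set₁
  Reached U r = ∀ n l → U ≤ n → n + r ≡ 1 + Q * l → Good (1 + k) n

  -- Write n = s w + u with s = 1 + Q e. Since s w ≡ -1 modulo Q, the order u lies in the class of
  -- r. The new bound leaves room for U ≤ u ≤ s.
  step : ∀ {U r} → Reached U r → let c = U + r in Reached (Q * (1 + c + (c + Q) * w)) (1 + r)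
  step {U} {r} reached n l U≤n n+r = subst (Good (1 + k)) (sym n≡)
      (wilson-MOLS (good-1+Ql e) T₀ T₁ u≤s (reached u l′ U≤u u+r))
    where
    c = U + r
    Xc = (c + Q) * w
    X≤l : 1 + c + Xc ≤ l
    X≤l = ℕ.*-cancelˡ-≤ Q (ℕ.≤-trans U≤n (ℕ.≤-trans (ℕ.m≤m+n n r)
      (ℕ.≤-reflexive (ℕ.suc-injective (trans (sym (ℕ.+-suc n r)) n+r)))))
    -- Now l = 1 + c + ρ + e w: the quotient e determines s, and the remainder ρ goes into u.
    l₀ = l ∸ (1 + c)
    l≡ : l ≡ 1 + c + l₀
    l≡ = sym (ℕ.m+[n∸m]≡n (ℕ.≤-trans (ℕ.m≤m+n (1 + c) Xc) X≤l))
    Xc≤l₀ : Xc ≤ l₀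
    Xc≤l₀ = ℕ.+-cancelˡ-≤ (1 + c) _ _ (ℕ.≤-trans X≤l (ℕ.≤-reflexive l≡))
    e = l₀ / w
    ρ = l₀ % w
    c+Q≤e : c + Q ≤ e
    c+Q≤e = subst (_≤ e) (ℕDM.m*n/n≡m (c + Q) w) (ℕDM./-monoˡ-≤ w Xc≤l₀)
    -- The summand c makes u at least U, and l′ ≤ e makes it at most s.
    l′ = c + ρ
    l′≤e : l′ ≤ e
    l′≤e = ℕ.≤-trans (ℕ.+-monoʳ-≤ c (ℕ.≤-trans (ℕ.<⇒≤ (ℕDM.m%n<n l₀ w)) (ℕ.n≤1+n w))) c+Q≤e
    c≤ : c ≤ 1 + Q * l′
    c≤ = ℕ.≤-trans (ℕ.m≤m+n c ρ) (ℕ.≤-trans (ℕ.m≤m+n l′ (w * l′)) (ℕ.n≤1+n _))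
    u = 1 + Q * l′ ∸ r
    u+r : u + r ≡ 1 + Q * l′
    u+r = ℕ.m∸n+n≡m (ℕ.≤-trans (ℕ.m≤n+m r U) c≤)
    U≤u : U ≤ u
    U≤u = ℕ.+-cancelʳ-≤ r _ _ (ℕ.≤-trans c≤ (ℕ.≤-reflexive (sym u+r)))
    u≤s : u ≤ 1 + Q * e
    u≤s = ℕ.≤-trans (ℕ.m∸n≤m _ r) (s≤s (ℕ.*-monoʳ-≤ Q l′≤e))
    identity : ∀ w e c ρ → 1 + suc w * (1 + c + (ρ + e * w)) ≡
               (1 + suc w * e) * w + (1 + suc w * (c + ρ)) + 1
    identity = ℕ.solve-∀
    n≡ : n ≡ (1 + Q * e) * w + u
    n≡ = ℕ.+-cancelʳ-≡ (1 + r) _ _ (begin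
      n + (1 + r)                                    ≡⟨ n+r ⟩
      1 + Q * l                                      ≡⟨ cong (λ x → 1 + Q * x) l≡ ⟩
      1 + Q * (1 + c + l₀)
        ≡⟨ cong (λ x → 1 + Q * (1 + c + x)) (ℕDM.m≡m%n+[m/n]*n l₀ w) ⟩
      1 + Q * (1 + c + (ρ + e * w))                  ≡⟨ identity w e c ρ ⟩
      (1 + Q * e) * w + (1 + Q * l′) + 1             ≡⟨ cong (λ x → (1 + Q * e) * w + x + 1) u+r ⟨
      (1 + Q * e) * w + (u + r) + 1                  ≡⟨ reassoc ((1 + Q * e) * w) u r ⟩
      (1 + Q * e) * w + u + (1 + r)                  ∎)
      where
      open ≡-Reasoning
      reassoc : ∀ a u r → a + (u + r) + 1 ≡ a + u + (1 + r)
      reassoc = ℕ.solve-∀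

  reach : ∀ r → ∃ λ U → Reached U r
  reach zero    = 0 , λ n l _ p →
    subst (Good (1 + k)) (trans (sym p) (ℕ.+-identityʳ n)) (restrict (restrict (good-1+Ql l)))
  reach (suc r) = _ , step (proj₂ (reach r))

  reach-all : ∀ r → ∃ λ U → ∀ r′ → r′ ≤ r → Reached U r′
  reach-all zero = proj₁ (reach 0) , λ { zero z≤n → proj₂ (reach 0) }
  reach-all (suc r) with reach (suc r) | reach-all r
  ... | U , f | V , g = U ⊔ V , both
    where
    both : ∀ r′ → r′ ≤ suc r → Reached (U ⊔ V) r′
    both r′ r′≤ n l UV≤n with ℕ.m≤n⇒m<n∨m≡n r′≤
    ... | inj₁ (s≤s r′≤r) = g r′ r′≤r n l (ℕ.m⊔n≤o⇒n≤o U V UV≤n)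
    ... | inj₂ refl       = f n l (ℕ.m⊔n≤o⇒m≤o U V UV≤n)

  eventually : ∃ λ N → ∀ n → N ≤ n → Good (1 + k) n
  eventually = from-bound (reach-all (suc Q))
    where
    open ≡-Reasoning
    shuffle : ∀ a b Q d → a + b * Q + suc d ≡ 1 + (a + d + Q * b)
    shuffle = ℕ.solve-∀
    from-bound : (∃ λ U → ∀ r → r ≤ suc Q → Reached U r) → ∃ λ N → ∀ n → N ≤ n → Good (1 + k) n
    from-bound (U , f) = U , λ n U≤n →
      -- Adding Q ∸ n % Q completes n to a multiple of Q; one more matches 1 + Q l, so r goes up to
      -- Q + 1.
      f (suc (Q ∸ n % Q)) (s≤s (ℕ.m∸n≤m Q (n % Q))) n (suc (n / Q)) U≤n (begin
      n + suc (Q ∸ n % Q)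
        ≡⟨ cong (_+ suc (Q ∸ n % Q)) (ℕDM.m≡m%n+[m/n]*n n Q) ⟩
      n % Q + n / Q * Q + suc (Q ∸ n % Q)          ≡⟨ shuffle (n % Q) (n / Q) Q (Q ∸ n % Q) ⟩
      1 + (n % Q + (Q ∸ n % Q) + Q * (n / Q))
        ≡⟨ cong (λ x → 1 + (x + Q * (n / Q))) (ℕ.m+[n∸m]≡n (ℕ.<⇒≤ (ℕDM.m%n<n n Q))) ⟩
      1 + (Q + Q * (n / Q))                        ≡⟨ cong suc (ℕ.*-suc Q (n / Q)) ⟨
      1 + Q * suc (n / Q)                          ∎)

MOLS-eventually : ∀ k → ∃ λ N → ∀ n → N ≤ n → Good (1 + k) n
MOLS-eventually k = from-multiple (Good-multiple (2 + k) ((2 + k) !) {{ℕ._!≢0 (2 + k)}})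
  where
  from-multiple : (∃ λ Q → Good (2 + k) Q × (2 + k) ! ∣ Q × 1 ≤ Q) →
                  ∃ λ N → ∀ n → N ≤ n → Good (1 + k) n
  -- Q = 1 would mean w = 0, but 2 divides the factorial and hence Q.
  from-multiple (suc zero , _ , D!∣1 , _) =
    ⊥-elim (ℕ.>⇒∤ ℕ.≤-refl (ℕ.∣-trans (d∣D! {2} {2 + k} (s≤s z≤n) (s≤s (s≤s z≤n))) D!∣1))
  from-multiple (suc (suc w) , good , D!∣Q , _) = Residues.eventually k (suc w)
    (λ { d 1≤d (s≤s d≤) → ℕ.∣-trans (d∣D! 1≤d d≤) D!∣Q }) good

-- Designs with a large hole

module LargeHole (t n₀ : ℕ) (large : ∀ n → n₀ ≤ n → Good (5 + t) n)
                 (q : ℕ) (good-q : Good (5 + t) (2 + q)) where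

  -- The field has order 2 + q, so W is (order - 1) z. Taking z above n₀ makes designs of orders
  -- near z and W available; C bounds every remainder in `imols`.
  k z W C : ℕ
  k = 2 + t
  z = suc n₀
  W = suc q * z
  C = n₀ + W

  n₀≤W : n₀ ≤ W
  n₀≤W = ℕ.≤-trans (ℕ.n≤1+n n₀) (ℕ.m≤m+n z (q * z))

  ingredient-small : ∀ w → n₀ ≤ w → Fin w → ∀ {a g} → a ≤ 1 → g ≤ 1 → ITD k w a g
  ingredient-small w n₀≤w x a≤1 g≤1 =
    small-holes x a≤1 g≤1 (restrict (restrict (large _ (ℕ.≤-trans n₀≤w (ℕ.m≤m+n w _)))))

  -- The weight g sits at the second point of its group, because `wilson-block` permits none at
  -- `zero`.
  ingredient-z : ∀ {g} → g ≤ 1 → ITD k W z g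
  ingredient-z {g} g≤1 = subst (ITD k W z)
      (trans (cong (λ x → g + x) (total-0 q)) (ℕ.+-identityʳ g))
      (wilson-block γ refl good-q (λ d → ingredient-small z (ℕ.n≤1+n n₀) zero z≤n (γ≤1 d)))
    where
    γ : Fin (2 + q) → ℕ
    γ = ∀-cons 0 (∀-cons g (λ _ → 0))
    γ≤1 : ∀ d → γ d ≤ 1
    γ≤1 = ∀-cons z≤n (∀-cons g≤1 (λ _ → z≤n))

  ingredient : ∀ {h g} → h ≡ 0 ⊎ h ≡ 1 ⊎ h ≡ z → g ≡ 0 ⊎ g ≡ 1 → ITD k W h g
  ingredient {g = g} h∈ g∈ = by h∈
    where
    bit≤1 : ∀ {g} → g ≡ 0 ⊎ g ≡ 1 → g ≤ 1
    bit≤1 (inj₁ refl) = z≤n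
    bit≤1 (inj₂ refl) = ℕ.≤-refl
    by : ∀ {h} → h ≡ 0 ⊎ h ≡ 1 ⊎ h ≡ z → ITD k W h g
    by (inj₁ refl)        = ingredient-small W n₀≤W zero z≤n (bit≤1 g∈)
    by (inj₂ (inj₁ refl)) = ingredient-small W n₀≤W zero ℕ.≤-refl (bit≤1 g∈)
    by (inj₂ (inj₂ refl)) = ingredient-z (bit≤1 g∈)

  assemble : ∀ {s x y u} → n₀ ≤ s → x + y ≤ s → u ≤ s → n₀ ≤ u →
             IMOLS t (x * z + y + (s * W + u)) (x * z + y)
  assemble {s} {x} {y} {u} n₀≤s xy≤s u≤s n₀≤u with weights z {s} x y xy≤s | bits {s} u u≤s
  ... | h , p , h∈ | γ , refl , γ∈ = subst (λ m → IMOLS t (m + (s * W + u)) m) p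
    (ITD⇒IMOLS (wilson h γ (restrict (large s n₀≤s)) λ c d → ingredient (h∈ c) (γ∈ d))
      (restrict (restrict (restrict (large u n₀≤u)))))

  -- Of the 3 + q shares of m, one is the hole, 1 + q cover x W ≤ (1 + q) m, and the last absorbs
  -- the constant n₀ + C W.
  imols : ∀ n m → n₀ + C * W ≤ m → (3 + q) * m ≤ n → IMOLS t n m
  imols n m N≤m qm≤n = subst₂ (IMOLS t) n≡ (sym m≡) (assemble {s} {x} {y} {n₀ + ρ}
      (ℕ.≤-trans (ℕ.≤-trans (ℕ.m≤m+n n₀ W) (ℕ.m≤n+m C x)) xC≤s)
      (ℕ.≤-trans (ℕ.+-monoʳ-≤ x y≤C) xC≤s)
      (ℕ.≤-trans (ℕ.≤-trans (ℕ.+-monoʳ-≤ n₀ (ℕ.<⇒≤ (ℕDM.m%n<n B W))) (ℕ.m≤n+m C x)) xC≤s)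
      (ℕ.m≤m+n n₀ ρ))
    where
    x = m / z
    y = m % z
    m≡ : m ≡ x * z + y
    m≡ = trans (ℕDM.m≡m%n+[m/n]*n m z) (ℕ.+-comm y (x * z))
    y≤C : y ≤ C
    y≤C = ℕ.≤-trans (ℕ.<⇒≤ (ℕDM.m%n<n m z)) (ℕ.≤-trans (ℕ.m≤m+n z (q * z)) (ℕ.m≤n+m W n₀))
    -- Setting n₀ aside first ensures that the hole to be filled, of size n₀ + ρ, has a good order.
    B = n ∸ m ∸ n₀
    s = B / W
    ρ = B % W
    enough : m + (n₀ + (x + C) * W) ≤ n
    enough = begin
      m + (n₀ + (x + C) * W)                       ≡⟨ rearrange m n₀ x C q z ⟩
      m + (suc q * (x * z) + (n₀ + C * W))
        ≤⟨ ℕ.+-monoʳ-≤ m (ℕ.+-mono-≤ (ℕ.*-monoʳ-≤ (suc q) (ℕDM.m/n*n≤m m z)) N≤m) ⟩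
      m + (suc q * m + m)                          ≡⟨ collect m q ⟩
      (3 + q) * m                                  ≤⟨ qm≤n ⟩
      n                                            ∎
      where
      open ℕ.≤-Reasoning
      rearrange : ∀ m n₀ x C q z → m + (n₀ + (x + C) * (suc q * z)) ≡
                  m + (suc q * (x * z) + (n₀ + C * (suc q * z)))
      rearrange = ℕ.solve-∀
      collect : ∀ m q → m + (suc q * m + m) ≡ (3 + q) * m
      collect = ℕ.solve-∀
    enough′ : n₀ + (x + C) * W ≤ n ∸ m
    enough′ = subst (_≤ n ∸ m) (ℕ.m+n∸m≡n m _) (ℕ.∸-monoˡ-≤ m enough)
    xC≤s : x + C ≤ s
    xC≤s = subst (_≤ s) (ℕDM.m*n/n≡m (x + C) W) (ℕDM./-monoˡ-≤ W
      (subst (_≤ B) (ℕ.m+n∸m≡n n₀ _) (ℕ.∸-monoˡ-≤ n₀ enough′)))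
    n≡ : x * z + y + (s * W + (n₀ + ρ)) ≡ n
    n≡ = begin
      x * z + y + (s * W + (n₀ + ρ))   ≡⟨ cong₂ _+_ (sym m≡) (swap (s * W) n₀ ρ) ⟩
      m + (n₀ + (ρ + s * W))           ≡⟨ cong (λ b → m + (n₀ + b)) (ℕDM.m≡m%n+[m/n]*n B W) ⟨
      m + (n₀ + B)
        ≡⟨ cong (λ x → m + x) (ℕ.m+[n∸m]≡n (ℕ.≤-trans (ℕ.m≤m+n n₀ _) enough′)) ⟩
      m + (n ∸ m)                      ≡⟨ ℕ.m+[n∸m]≡n (ℕ.≤-trans (ℕ.m≤m+n m _) enough) ⟩
      n                                ∎
      where
      open ≡-Reasoning
      swap : ∀ a b c → a + (b + c) ≡ b + (c + a)
      swap = ℕ.solve-∀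

-- The number of squares is `suc t` here; the added polynomial is the exact difference of the two
-- sides.
q+1≤8[t+1]² : ∀ t → 1 + (5 + t) * (5 + t) ≤ 8 * (suc t + 1) ^ 2
q+1≤8[t+1]² t = ℕ.≤-trans (ℕ.m≤m+n _ (7 * t * t + 22 * t + 6)) (ℕ.≤-reflexive (identity t))
  where
  identity : ∀ t → 1 + (5 + t) * (5 + t) + (7 * t * t + 22 * t + 6) ≡
             8 * ((suc t + 1) * ((suc t + 1) * 1))
  identity = ℕ.solve-∀

theorem1p1 : (t : ℕ) → 1 ≤ t →
    ∃[ N ] ((n m : ℕ) → N ≤ n → N ≤ m → 8 * (t + 1) ^ 2 * m ≤ n → IMOLS t n m)
theorem1p1 (suc t) _ with MOLS-eventually (5 + t)
... | n₀ , large =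
  -- The lower bound 6 + t provides one evaluation point for each group required by `LargeHole`.
  let F , lower , upper = field-near (3 + t) in use lower upper (field-Good F lower)
  where
  use : ∀ {q} → 6 + t ≤ q → q ≤ (5 + t) * (5 + t) → Good (6 + t) q →
        ∃[ N ] ((n m : ℕ) → N ≤ n → N ≤ m → 8 * (suc t + 1) ^ 2 * m ≤ n → IMOLS (suc t) n m)
  -- With the order written as 2 + q, the factor 3 + q in `imols` is the order plus one.
  use {suc (suc q)} _ upper good = _ , λ n m _ N≤m 8m≤n → LargeHole.imols (suc t) n₀ large q good
    n m N≤m (ℕ.≤-trans (ℕ.*-monoˡ-≤ m (ℕ.≤-trans (s≤s upper) (q+1≤8[t+1]² t))) 8m≤n)
  use {0} ()
  use {1} (s≤s ())
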